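{- Let $\nu,\mu$ be computable probability measures on Cantor space $2^{\mathbb{N}}$ with full support. If $\nu\ll_{\mathsf{MLR}} \mu$, then $\nu$ is absolutely continuous with respect to $\mu$, i.e. $\nu\ll \mu$.
   Context: A probability measure $\nu$ on Cantor space is computable if the reals $\nu([\sigma])$ are computable uniformly in $\sigma\in2^{<\mathbb{N}}$, where $[\sigma]$ is the set of $\omega\in 2^{\mathbb{N}}$ extending $\sigma$; it has full support if $\nu([\sigma])>0$ for all $\sigma$. A c.e. open set is one of the form $\bigcup_n[\sigma_n]$ for a computable sequence $\sigma_n$ of binary strings. $\mathsf{MLR}^{\nu}$ (Martin-Löf $\nu$-random points) is the set of $\omega$ such that $\omega\notin\bigcap_n U_n$ for every computable sequence $U_n$ of c.e. opens with $\nu(U_n)\le 2^{ -n}$ for all $n\ge 0$. $\nu\ll_{\mathsf{MLR}}\mu$ means $\mathsf{MLR}^{\nu}\subseteq\mathsf{MLR}^{\mu}$. -}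

module Defs where

open import Data.Bool using (Bool; true; false)
open import Data.Fin using (Fin)
open import Data.Integer using (_⊖_)
open import Data.List using (List; []; _∷_)
open import Data.Nat as ℕ using (ℕ; zero; suc)
open import Data.Product using (Σ; ∃; _×_; _,_)
open import Data.Rational as ℚ using (ℚ; 0ℚ; 1ℚ; ½)
open import Data.Rational.Properties as ℚₚ
open import Data.Rational.Solver using (module +-*-Solver)
open import Data.Unit using (⊤)
open import Data.Vec using (Vec; []; _∷_; lookup)
open import Data.Vec.Relation.Binary.Pointwise.Inductive using (Pointwise)
open import Function using (_∘_)
open import Level using (0ℓ)
open import Relation.Binary.PropositionalEquality
open import Relation.Nullary using (¬_)
open import Relation.Unary using (Pred; _∈_; _⊆_; _⊥_; _≐_)

-- Real numbers are Bishop's regular Cauchy sequences, with dyadic modulus.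

infix 9 2^-_
2^-_ : ℕ → ℚ
2^- zero  = 1ℚ
2^- suc n = ½ ℚ.* 2^- n

2^-nonneg : ∀ n → 0ℚ ℚ.≤ 2^- n
2^-nonneg zero    = ℚₚ.nonNegative⁻¹ 1ℚ
2^-nonneg (suc n) = ℚₚ.≤-trans (ℚₚ.≤-reflexive (sym (ℚₚ.*-zeroʳ ½)))
                               (ℚₚ.*-monoˡ-≤-nonNeg ½ (2^-nonneg n))

2^-halves : ∀ n → 2^- suc n ℚ.+ 2^- suc n ≡ 2^- n
2^-halves n = trans (sym (ℚₚ.*-distribʳ-+ (2^- n) ½ ½)) (ℚₚ.*-identityˡ (2^- n))

record ℝ : Set where
  constructor mkℝ
  field
    approx  : ℕ → ℚ
    regular : ∀ m n → ℚ.∣ approx m ℚ.- approx n ∣ ℚ.≤ 2^- m ℚ.+ 2^- n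

open ℝ public

infix 4 _≤ᴿ_ _<ᴿ_ _≃ᴿ_

-- The n-th approximation is within 2^-n of the real it represents.

_≤ᴿ_ : ℝ → ℝ → Set
x ≤ᴿ y = ∀ n → approx x n ℚ.≤ approx y n ℚ.+ (2^- n ℚ.+ 2^- n)

_<ᴿ_ : ℝ → ℝ → Set
x <ᴿ y = ∃ λ n → approx x n ℚ.+ (2^- n ℚ.+ 2^- n) ℚ.< approx y n

_≃ᴿ_ : ℝ → ℝ → Set
x ≃ᴿ y = x ≤ᴿ y × y ≤ᴿ x

fromℚ : ℚ → ℝ
fromℚ q = mkℝ (λ _ → q) λ m n →
  subst (ℚ._≤ 2^- m ℚ.+ 2^- n) (cong ℚ.∣_∣ (sym (ℚₚ.+-inverseʳ q)))
        (ℚₚ.+-mono-≤ (2^-nonneg m) (2^-nonneg n))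

0ᴿ 1ᴿ : ℝ
0ᴿ = fromℚ 0ℚ
1ᴿ = fromℚ 1ℚ

infixl 6 _+ᴿ_
_+ᴿ_ : ℝ → ℝ → ℝ
x +ᴿ y = mkℝ (λ n → approx x (suc n) ℚ.+ approx y (suc n)) reg
  where
  open +-*-Solver
  rearrange : ∀ a b c d → (a ℚ.+ b) ℚ.- (c ℚ.+ d) ≡ (a ℚ.- c) ℚ.+ (b ℚ.- d)
  rearrange = solve 4 (λ a b c d → (a :+ b) :- (c :+ d) := (a :- c) :+ (b :- d)) refl
  regroup : ∀ a b → (a ℚ.+ b) ℚ.+ (a ℚ.+ b) ≡ (a ℚ.+ a) ℚ.+ (b ℚ.+ b)
  regroup = solve 2 (λ a b → (a :+ b) :+ (a :+ b) := (a :+ a) :+ (b :+ b)) refl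
  reg : ∀ m n → ℚ.∣ (approx x (suc m) ℚ.+ approx y (suc m))
                    ℚ.- (approx x (suc n) ℚ.+ approx y (suc n)) ∣
                ℚ.≤ 2^- m ℚ.+ 2^- n
  reg m n = begin
    ℚ.∣ (xm ℚ.+ ym) ℚ.- (xn ℚ.+ yn) ∣          ≡⟨ cong ℚ.∣_∣ (rearrange xm ym xn yn) ⟩
    ℚ.∣ (xm ℚ.- xn) ℚ.+ (ym ℚ.- yn) ∣          ≤⟨ ℚₚ.∣p+q∣≤∣p∣+∣q∣ (xm ℚ.- xn) (ym ℚ.- yn) ⟩
    ℚ.∣ xm ℚ.- xn ∣ ℚ.+ ℚ.∣ ym ℚ.- yn ∣        ≤⟨ ℚₚ.+-mono-≤ (regular x (suc m) (suc n))
                                                              (regular y (suc m) (suc n)) ⟩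
    (em ℚ.+ en) ℚ.+ (em ℚ.+ en)                ≡⟨ regroup em en ⟩
    (em ℚ.+ em) ℚ.+ (en ℚ.+ en)                ≡⟨ cong₂ ℚ._+_ (2^-halves m) (2^-halves n) ⟩
    2^- m ℚ.+ 2^- n                            ∎
    where
    open ℚₚ.≤-Reasoning
    xm = approx x (suc m)
    xn = approx x (suc n)
    ym = approx y (suc m)
    yn = approx y (suc n)
    em = 2^- suc m
    en = 2^- suc n

-- x ≈[ ε ] y  means  |x − y| ≤ ε.
infix 4 _≈[_]_
_≈[_]_ : ℝ → ℚ → ℝ → Set
x ≈[ ε ] y = x ≤ᴿ y +ᴿ fromℚ ε × y ≤ᴿ x +ᴿ fromℚ ε

partialSum : (ℕ → ℝ) → ℕ → ℝ
partialSum s zero    = 0ᴿ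
partialSum s (suc n) = partialSum s n +ᴿ s n

infix 4 _⟶_
_⟶_ : (ℕ → ℝ) → ℝ → Set
s ⟶ l = ∀ ε → 0ℚ ℚ.< ε → ∃ λ N → ∀ n → N ℕ.≤ n → s n ≈[ ε ] l

-- μ-recursive codes; ⇓ may be partial, computable functions are the total ones.

data Code : ℕ → Set where
  zeroᶜ : Code 0
  sucᶜ  : Code 1
  proj  : ∀ {n} → Fin n → Code n
  comp  : ∀ {m n} → Code m → Vec (Code n) m → Code n
  prec  : ∀ {n} → Code n → Code (2 ℕ.+ n) → Code (1 ℕ.+ n)
  mini  : ∀ {n} → Code (1 ℕ.+ n) → Code n

infix 4 _[_]⇓_
data _[_]⇓_ : ∀ {n} → Code n → Vec ℕ n → ℕ → Set where
  ⇓-zero : zeroᶜ [ [] ]⇓ 0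
  ⇓-suc  : ∀ {x} → sucᶜ [ x ∷ [] ]⇓ suc x
  ⇓-proj : ∀ {n} {i : Fin n} {xs} → proj i [ xs ]⇓ lookup xs i
  ⇓-comp : ∀ {m n} {f : Code m} {gs : Vec (Code n) m} {xs ys z} →
           Pointwise (λ g y → g [ xs ]⇓ y) gs ys → f [ ys ]⇓ z →
           comp f gs [ xs ]⇓ z
  ⇓-prec-zero : ∀ {n} {f : Code n} {g xs y} →
                f [ xs ]⇓ y → prec f g [ 0 ∷ xs ]⇓ y
  ⇓-prec-suc  : ∀ {n} {f : Code n} {g xs k r y} →
                prec f g [ k ∷ xs ]⇓ r → g [ k ∷ r ∷ xs ]⇓ y →
                prec f g [ suc k ∷ xs ]⇓ y
  ⇓-mini : ∀ {n} {f : Code (1 ℕ.+ n)} {xs k} →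
           (∀ j → j ℕ.< k → ∃ λ y → f [ j ∷ xs ]⇓ suc y) →
           f [ k ∷ xs ]⇓ 0 → mini f [ xs ]⇓ k

Computable₂ : (ℕ → ℕ → ℕ) → Set
Computable₂ f = Σ (Code 2) λ c → ∀ m n → c [ m ∷ n ∷ [] ]⇓ f m n

-- A rational is presented as (a − b) / (d + 1) with a, b, d natural.
Computable₂ℚ : (ℕ → ℕ → ℚ) → Set
Computable₂ℚ q =
  ∃ λ a → ∃ λ b → ∃ λ d →
    Computable₂ a × Computable₂ b × Computable₂ d ×
    (∀ m n → q m n ≡ (a m n ⊖ b m n) ℚ./ suc (d m n))

bit : Bool → ℕ
bit false = 0
bit true  = 1

-- Bijective base-2 numbering, first bit least significant.
code : List Bool → ℕ
code []      = 0
code (b ∷ σ) = suc (bit b ℕ.+ 2 ℕ.* code σ)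

Computable₂String : (ℕ → ℕ → List Bool) → Set
Computable₂String σ = Computable₂ (λ m n → code (σ m n))

Cantor : Set
Cantor = ℕ → Bool

infix 4 _≺_
_≺_ : List Bool → Cantor → Set
[]      ≺ ω = ⊤
(b ∷ σ) ≺ ω = b ≡ ω 0 × σ ≺ (ω ∘ suc)

-- Borel codes; the Borel sets are the extensions ⟦ A ⟧.
data Borel : Set where
  cyl : List Bool → Borel
  ∁_  : Borel → Borel
  ⋃_  : (ℕ → Borel) → Borel

⟦_⟧ : Borel → Pred Cantor 0ℓ
⟦ cyl σ ⟧ ω = σ ≺ ω
⟦ ∁ A   ⟧ ω = ¬ ⟦ A ⟧ ω
⟦ ⋃ A   ⟧ ω = ∃ λ n → ⟦ A n ⟧ ω

full empty : Borel
full  = cyl []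
empty = ∁ full

open[_] : (ℕ → List Bool) → Borel
open[ σ ] = ⋃ (λ n → cyl (σ n))

record ProbabilityMeasure : Set where
  field
    measure     : Borel → ℝ
    -- the value depends only on the set, not on its code
    extensional : ∀ A B → ⟦ A ⟧ ≐ ⟦ B ⟧ → measure A ≃ᴿ measure B
    nonneg      : ∀ A → 0ᴿ ≤ᴿ measure A
    null-empty  : measure empty ≃ᴿ 0ᴿ
    total       : measure full ≃ᴿ 1ᴿ
    σ-additive  : ∀ (A : ℕ → Borel) → (∀ i j → i ≢ j → ⟦ A i ⟧ ⊥ ⟦ A j ⟧) →
                  partialSum (λ i → measure (A i)) ⟶ measure (⋃ A)

open ProbabilityMeasure public

FullSupport : ProbabilityMeasure → Set
FullSupport ν = ∀ σ → 0ᴿ <ᴿ measure ν (cyl σ)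

ComputableMeasure : ProbabilityMeasure → Set
ComputableMeasure ν =
  ∃ λ (q : ℕ → ℕ → ℚ) → Computable₂ℚ q ×
    (∀ σ n → fromℚ (q (code σ) n) ≈[ 2^- n ] measure ν (cyl σ))

-- A uniform sequence of c.e. opens Uₙ = ⋃ₘ [σ n m] is given by a computable
-- double sequence of strings.
MLTest : ProbabilityMeasure → (ℕ → ℕ → List Bool) → Set
MLTest ν σ = Computable₂String σ × (∀ n → measure ν open[ σ n ] ≤ᴿ fromℚ (2^- n))

MLR : ProbabilityMeasure → Pred Cantor 0ℓ
MLR ν ω = ∀ σ → MLTest ν σ → ¬ (∀ n → ω ∈ ⟦ open[ σ n ] ⟧)

infix 4 _≪_ _≪MLR_

_≪MLR_ : ProbabilityMeasure → ProbabilityMeasure → Set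
ν ≪MLR μ = MLR ν ⊆ MLR μ

_≪_ : ProbabilityMeasure → ProbabilityMeasure → Set
ν ≪ μ = ∀ A → measure μ A ≃ᴿ 0ᴿ → measure ν A ≃ᴿ 0ᴿ

{-# OPTIONS --safe #-}

-- Let Uₙ be the union of the cylinders [τ] with 2ⁿ μ[τ] < ν[τ]. Comparing the two measures on the
-- maximal such cylinders gives 2ⁿ μ(Uₙ) ≤ 1 (Ville's inequality), so (Uₙ) is a Martin-Löf μ-test:
-- it can be enumerated from approximations to ν and μ. Off Uₙ every cylinder satisfies ν ≤ 2ⁿ μ, and
-- since Borel sets are approximable by clopen sets, ν(A ∖ Uₙ) ≤ 2ⁿ μ(A) for all Borel A. If μ(A) = 0,
-- then ν-almost every point of A lies in ⋂ₙ Uₙ, hence is not μ-random, hence not ν-random; but there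
-- are only countably many tests, so the points that are not ν-random form a ν-null set.
-- The detected cylinders only satisfy 2ⁿ μ[τ] ≤ ν[τ] and contain all those with strict inequality,
-- which is enough; if for some n there is no strict inequality at all, then ν ≤ 2ⁿ μ outright.

module Submission where

open import Defs
open import Axiom.ExcludedMiddle using (ExcludedMiddle)
open import Level using (0ℓ)
open import Data.Bool using (Bool; true; false)
open import Data.Empty using (⊥-elim)
open import Data.Fin as Fin using (Fin)
open import Data.Fin.Patterns using (0F; 1F; 2F)
open import Data.Integer as ℤ using (_⊖_)
import Data.Integer.Properties as ℤₚ
open import Data.List using (List; []; _∷_; _++_; _∷ʳ_; length)
import Data.List.Properties as Listₚ
open import Data.Nat as ℕ using (ℕ; zero; suc)
import Data.Nat.Properties as ℕₚ
open import Data.Product using (Σ; ∃; _×_; _,_; proj₁; proj₂; uncurry)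
open import Data.Rational as ℚ using (ℚ; 0ℚ; 1ℚ; ½; _+_; _-_; _*_; -_; _≤_; _<_; _/_)
import Data.Rational.Properties as ℚₚ
open import Data.Rational.Solver using (module +-*-Solver)
open import Data.Rational.Unnormalised as ℚᵘ using (mkℚᵘ)
import Data.Rational.Unnormalised.Properties as ℚᵘₚ
open import Data.Sum using (_⊎_; inj₁; inj₂; [_,_]′)
open import Data.Unit using (⊤; tt)
open import Data.Vec using (Vec; []; _∷_; lookup)
open import Data.Vec.Relation.Binary.Pointwise.Inductive using (Pointwise; []; _∷_)
open import Function using (_∘_; id)
open import Relation.Binary using (tri<; tri≈; tri>)
open import Relation.Binary.Bundles using (Preorder)
open import Relation.Binary.PropositionalEquality
import Relation.Binary.Reasoning.Preorder as PreorderReasoning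
open import Relation.Nullary using (¬_; Dec; yes; no)
open import Relation.Nullary.Decidable using (decidable-stable)
open import Relation.Unary using (_∈_; _⊆_; _⊥_; _≐_; U; ∅)

open +-*-Solver using (solve; _:=_; _:+_; _:-_; _:*_; con)

-- Rational numbers

-- A c.e. open set is presented by a total computable sequence of strings, so it is never empty and
-- its enumeration may never pause. This forces the final case distinction: accepted stages are
-- found by unbounded search, which halts only if there are always more of them. A single string
-- with strict inequality at level n ensures this. Its gap is noticed at every late enough stage
-- that inspects it, and each string is inspected infinitely often. The inequality between two
-- computable reals cannot be decided, only a comparison of their rational approximations can. The
-- threshold therefore carries a safety margin that shrinks with the stage: acceptance is always
-- correct, and a genuine gap outlasts the margin. No density and no Lebesgue decomposition is
-- constructed. The bound off each level of the test is proved on cylinders and carried to Borel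
-- sets by approximation in the sum of the two measures involved. Multiplication by a power of two
-- is repeated addition, so the reals need an order and a sum but no product.

≤-by-difference : ∀ {a b x y} → a ≤ b → y - x ≡ b - a → x ≤ y
≤-by-difference {a} {b} {x} {y} a≤b eq =
  subst₂ _≤_ left (right b y) (ℚₚ.+-monoˡ-≤ (y - b) a≤b)
  where
  right : ∀ b y → b + (y - b) ≡ y
  right = solve 2 (λ b y → b :+ (y :- b) := y) refl
  shift : ∀ a b y → a + (y - b) ≡ y - (b - a)
  shift = solve 3 (λ a b y → a :+ (y :- b) := y :- (b :- a)) refl
  back : ∀ x y → y - (y - x) ≡ x
  back = solve 2 (λ x y → y :- (y :- x) := x) refl
  left : a + (y - b) ≡ x
  left = trans (shift a b y) (trans (cong (λ z → y - z) (sym eq)) (back x y))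

<⇒≱ : ∀ {p q} → p < q → ¬ q ≤ p
<⇒≱ p<q q≤p = ℚₚ.<-irrefl refl (ℚₚ.<-≤-trans p<q q≤p)

fromℕ : ℕ → ℚ
fromℕ zero    = 0ℚ
fromℕ (suc n) = 1ℚ + fromℕ n

fromℕ-homo-+ : ∀ m n → fromℕ (m ℕ.+ n) ≡ fromℕ m + fromℕ n
fromℕ-homo-+ zero    n = sym (ℚₚ.+-identityˡ (fromℕ n))
fromℕ-homo-+ (suc m) n =
  trans (cong (1ℚ +_) (fromℕ-homo-+ m n)) (sym (ℚₚ.+-assoc 1ℚ (fromℕ m) (fromℕ n)))

fromℕ-homo-* : ∀ m n → fromℕ (m ℕ.* n) ≡ fromℕ m * fromℕ n
fromℕ-homo-* zero    n = sym (ℚₚ.*-zeroˡ (fromℕ n))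
fromℕ-homo-* (suc m) n = begin
  fromℕ (n ℕ.+ m ℕ.* n)                ≡⟨ fromℕ-homo-+ n (m ℕ.* n) ⟩
  fromℕ n + fromℕ (m ℕ.* n)            ≡⟨ cong₂ _+_ (sym (ℚₚ.*-identityˡ (fromℕ n))) (fromℕ-homo-* m n) ⟩
  1ℚ * fromℕ n + fromℕ m * fromℕ n     ≡⟨ sym (ℚₚ.*-distribʳ-+ (fromℕ n) 1ℚ (fromℕ m)) ⟩
  (1ℚ + fromℕ m) * fromℕ n             ∎
  where open ≡-Reasoning

0≤1 : 0ℚ ≤ 1ℚ
0≤1 = ℚₚ.nonNegative⁻¹ 1ℚ

fromℕ-nonneg : ∀ n → 0ℚ ≤ fromℕ n
fromℕ-nonneg zero    = ℚₚ.≤-refl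
fromℕ-nonneg (suc n) = ℚₚ.+-mono-≤ 0≤1 (fromℕ-nonneg n)

fromℕ-mono-≤ : ∀ {m n} → m ℕ.≤ n → fromℕ m ≤ fromℕ n
fromℕ-mono-≤ {n = n} ℕ.z≤n = fromℕ-nonneg n
fromℕ-mono-≤ (ℕ.s≤s m≤n)   = ℚₚ.+-monoʳ-≤ 1ℚ (fromℕ-mono-≤ m≤n)

fromℕ-suc-positive : ∀ n → 0ℚ < fromℕ (suc n)
fromℕ-suc-positive n = ℚₚ.+-mono-<-≤ (ℚₚ.positive⁻¹ 1ℚ) (fromℕ-nonneg n)

fromℕ-mono-< : ∀ {m n} → m ℕ.< n → fromℕ m < fromℕ n
fromℕ-mono-< {zero}  {suc n} _           = fromℕ-suc-positive n
fromℕ-mono-< {suc m} {suc n} (ℕ.s≤s m<n) = ℚₚ.+-monoʳ-< 1ℚ (fromℕ-mono-< m<n)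

fromℕ-cancel-≤ : ∀ {m n} → fromℕ m ≤ fromℕ n → m ℕ.≤ n
fromℕ-cancel-≤ {m} {n} p with m ℕ.≤? n
... | yes m≤n = m≤n
... | no  m≰n = ⊥-elim (<⇒≱ (fromℕ-mono-< (ℕₚ.≰⇒> m≰n)) p)

fromℕ≡/1 : ∀ n → fromℕ n ≡ ℤ.+ n / 1
fromℕ≡/1 zero    = refl
fromℕ≡/1 (suc n) = trans (cong (1ℚ +_) (fromℕ≡/1 n)) (ℚₚ.toℚᵘ-injective (begin
  ℚ.toℚᵘ (1ℚ + (ℤ.+ n / 1))            ≈⟨ ℚₚ.toℚᵘ-homo-+ 1ℚ (ℤ.+ n / 1) ⟩
  ℚ.toℚᵘ 1ℚ ℚᵘ.+ ℚ.toℚᵘ (ℤ.+ n / 1)    ≈⟨ ℚᵘₚ.+-congʳ (ℚ.toℚᵘ 1ℚ) (ℚₚ.toℚᵘ-fromℚᵘ (mkℚᵘ (ℤ.+ n) 0)) ⟩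
  ℚ.toℚᵘ 1ℚ ℚᵘ.+ mkℚᵘ (ℤ.+ n) 0        ≈⟨ ℚᵘ.*≡* (cong (λ i → i ℤ.* ℤ.+ 1) (cong (λ i → ℤ.+ 1 ℤ.+ i) (ℤₚ.*-identityʳ (ℤ.+ n)))) ⟩
  mkℚᵘ (ℤ.+ suc n) 0                   ≈⟨ ℚₚ.toℚᵘ-fromℚᵘ (mkℚᵘ (ℤ.+ suc n) 0) ⟨
  ℚ.toℚᵘ (ℤ.+ suc n / 1)               ∎))
  where open ℚᵘₚ.≃-Reasoning

/-*-denominator : ∀ i d → i / suc d * fromℕ (suc d) ≡ i / 1
/-*-denominator i d = trans (cong (i / suc d *_) (fromℕ≡/1 (suc d))) (ℚₚ.toℚᵘ-injective (begin
  ℚ.toℚᵘ (i / suc d * (ℤ.+ suc d / 1))             ≈⟨ ℚₚ.toℚᵘ-homo-* (i / suc d) (ℤ.+ suc d / 1) ⟩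
  ℚ.toℚᵘ (i / suc d) ℚᵘ.* ℚ.toℚᵘ (ℤ.+ suc d / 1)   ≈⟨ ℚᵘₚ.*-cong (ℚₚ.toℚᵘ-fromℚᵘ (mkℚᵘ i d)) (ℚₚ.toℚᵘ-fromℚᵘ (mkℚᵘ (ℤ.+ suc d) 0)) ⟩
  mkℚᵘ i d ℚᵘ.* mkℚᵘ (ℤ.+ suc d) 0                 ≈⟨ ℚᵘ.*≡* (trans (ℤₚ.*-identityʳ (i ℤ.* ℤ.+ suc d)) (cong (λ e → i ℤ.* ℤ.+ suc e) (sym (ℕₚ.*-identityʳ d)))) ⟩
  mkℚᵘ i 0                                       ≈⟨ ℚₚ.toℚᵘ-fromℚᵘ (mkℚᵘ i 0) ⟨
  ℚ.toℚᵘ (i / 1)                                 ∎))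
  where open ℚᵘₚ.≃-Reasoning

neg-/1 : ∀ n → (ℤ.- (ℤ.+ n)) / 1 ≡ - (ℤ.+ n / 1)
neg-/1 zero    = refl
neg-/1 (suc n) = refl

⊖-/1 : ∀ m n → (m ⊖ n) / 1 ≡ fromℕ m - fromℕ n
⊖-/1 m       zero    = trans (sym (fromℕ≡/1 m)) (sym (ℚₚ.+-identityʳ (fromℕ m)))
⊖-/1 zero    (suc n) = trans (cong (λ q → - q) (sym (fromℕ≡/1 (suc n)))) (sym (ℚₚ.+-identityˡ (- fromℕ (suc n))))
⊖-/1 (suc m) (suc n) =
  trans (cong (λ i → i / 1) (ℤₚ.[1+m]⊖[1+n]≡m⊖n m n))
        (trans (⊖-/1 m n) (cancel (fromℕ m) (fromℕ n) 1ℚ))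
  where
  cancel : ∀ a b c → a - b ≡ (c + a) - (c + b)
  cancel = solve 3 (λ a b c → a :- b := (c :+ a) :- (c :+ b)) refl

⊖-/-*-denominator : ∀ a b d → (a ⊖ b) / suc d * fromℕ (suc d) ≡ fromℕ a - fromℕ b
⊖-/-*-denominator a b d = trans (/-*-denominator (a ⊖ b) d) (⊖-/1 a b)

2^-positive : ∀ n → 0ℚ < 2^- n
2^-positive zero    = ℚₚ.positive⁻¹ 1ℚ
2^-positive (suc n) = subst (_< 2^- suc n) (ℚₚ.*-zeroʳ ½) (ℚₚ.*-monoʳ-<-pos ½ (2^-positive n))

2^-suc-≤ : ∀ n → 2^- suc n ≤ 2^- n
2^-suc-≤ n = subst₂ _≤_ (ℚₚ.+-identityʳ (2^- suc n)) (2^-halves n) (ℚₚ.+-monoʳ-≤ (2^- suc n) (2^-nonneg (suc n)))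

2^-antimono : ∀ {m n} → m ℕ.≤ n → 2^- n ≤ 2^- m
2^-antimono m≤n = go (ℕₚ.≤⇒≤′ m≤n)
  where
  go : ∀ {m n} → m ℕ.≤′ n → 2^- n ≤ 2^- m
  go ℕ.≤′-refl           = ℚₚ.≤-refl
  go (ℕ.≤′-step {n} m≤n) = ℚₚ.≤-trans (2^-suc-≤ n) (go m≤n)

2^-inverse : ∀ n → 2^- n * fromℕ (2 ℕ.^ n) ≡ 1ℚ
2^-inverse zero    = refl
2^-inverse (suc n) = begin
  ½ * 2^- n * fromℕ (2 ℕ.* 2 ℕ.^ n)            ≡⟨ cong (½ * 2^- n *_) (fromℕ-homo-* 2 (2 ℕ.^ n)) ⟩
  ½ * 2^- n * (fromℕ 2 * fromℕ (2 ℕ.^ n))      ≡⟨ swap ½ (2^- n) (fromℕ 2) (fromℕ (2 ℕ.^ n)) ⟩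
  ½ * fromℕ 2 * (2^- n * fromℕ (2 ℕ.^ n))      ≡⟨ cong (½ * fromℕ 2 *_) (2^-inverse n) ⟩
  ½ * fromℕ 2 * 1ℚ                             ≡⟨⟩
  1ℚ                                           ∎
  where
  open ≡-Reasoning
  swap : ∀ a b c d → a * b * (c * d) ≡ a * c * (b * d)
  swap = solve 4 (λ a b c d → a :* b :* (c :* d) := a :* c :* (b :* d)) refl

n<2^n : ∀ n → n ℕ.< 2 ℕ.^ n
n<2^n zero    = ℕ.s≤s ℕ.z≤n
n<2^n (suc n) = ℕₚ.≤-trans (ℕ.s≤s (n<2^n n))
  (ℕₚ.+-mono-≤ (ℕₚ.≤-trans (ℕ.s≤s ℕ.z≤n) (n<2^n n)) (ℕₚ.≤-reflexive (sym (ℕₚ.+-identityʳ (2 ℕ.^ n)))))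

2^-below : ∀ {p} → 0ℚ < p → ∃ λ n → 2^- n < p
2^-below {p} 0<p = below p (ℚ.positive 0<p)
  where
  below : ∀ p → ℚ.Positive p → ∃ λ n → 2^- n < p
  -- For p = (k+1)/(d+1) the exponent d+1 works, since 2^-(d+1) (d+1) < 1 ≤ k+1 = p (d+1).
  below p@(ℚ.mkℚ (ℤ.+ suc k) d _) _ = n , ℚₚ.≰⇒> λ p≤2^-n → <⇒≱
      (ℚₚ.*-monoʳ-<-pos (2^- n) {{ℚ.positive (2^-positive n)}} (fromℕ-mono-< (n<2^n n)))
      (begin
        2^- n * fromℕ (2 ℕ.^ n)   ≡⟨ 2^-inverse n ⟩
        1ℚ                        ≤⟨ fromℕ-mono-≤ {1} {suc k} (ℕ.s≤s ℕ.z≤n) ⟩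
        fromℕ (suc k)             ≡⟨ fromℕ≡/1 (suc k) ⟩
        ℤ.+ suc k / 1               ≡⟨ /-*-denominator (ℤ.+ suc k) d ⟨
        ℤ.+ suc k / suc d * fromℕ n ≡⟨ cong (_* fromℕ n) (ℚₚ.↥p/↧p≡p p) ⟩
        p * fromℕ n               ≤⟨ ℚₚ.*-monoʳ-≤-nonNeg (fromℕ n) {{ℚ.nonNegative (fromℕ-nonneg n)}} p≤2^-n ⟩
        2^- n * fromℕ n           ∎)
    where
    open ℚₚ.≤-Reasoning
    n = suc d

≤-archimedean : ∀ {p q} → (∀ n → p ≤ q + 2^- n) → p ≤ q
≤-archimedean {p} {q} h with p ℚₚ.≤? q
... | yes p≤q = p≤q
... | no  p≰q with 2^-below {p - q} (subst (_< p - q) (ℚₚ.+-inverseʳ q) (ℚₚ.+-monoˡ-< (- q) (ℚₚ.≰⇒> p≰q)))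
...   | n , 2^-n<p-q = ⊥-elim (<⇒≱ (subst (q + 2^- n <_) (cancel p q) (ℚₚ.+-monoʳ-< q 2^-n<p-q)) (h n))
  where
  cancel : ∀ p q → q + (p - q) ≡ p
  cancel = solve 2 (λ p q → q :+ (p :- q) := p) refl

-- Real numbers

-- The indices on the two sides are independent, which absorbs the index shift in _+ᴿ_.
infix 4 _≤[_]_
_≤[_]_ : ℝ → ℚ → ℝ → Set
x ≤[ e ] y = ∃ λ N → ∀ {k l} → N ℕ.≤ k → N ℕ.≤ l → approx x k ≤ approx y l + e

infix 4 _≼_
-- Equivalent to `≤ᴿ`, as the two conversions below show. The record wrapper lets both reals be
-- inferred from a proof.
record _≼_ (x y : ℝ) : Set where
  field within : ∀ j → x ≤[ 2^- j ] y

open _≼_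

p≤∣p∣ : ∀ p → p ≤ ℚ.∣ p ∣
p≤∣p∣ p with ℚₚ.≤-total 0ℚ p
... | inj₁ 0≤p = ℚₚ.≤-reflexive (sym (ℚₚ.0≤p⇒∣p∣≡p 0≤p))
... | inj₂ p≤0 = ℚₚ.≤-trans p≤0 (ℚₚ.0≤∣p∣ p)

approx-close : ∀ x m n → approx x m ≤ approx x n + (2^- m + 2^- n)
approx-close x m n = ≤-by-difference (ℚₚ.≤-trans (p≤∣p∣ (approx x m - approx x n)) (regular x m n))
  (lemma (approx x m) (approx x n) (2^- m + 2^- n))
  where
  lemma : ∀ a b e → (b + e) - a ≡ e - (a - b)
  lemma = solve 3 (λ a b e → (b :+ e) :- a := e :- (a :- b)) refl

approx-close-≥ : ∀ x j {k l} → suc j ℕ.≤ k → suc j ℕ.≤ l → approx x k ≤ approx x l + 2^- j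
approx-close-≥ x j {k} {l} j<k j<l = ℚₚ.≤-trans (approx-close x k l) (ℚₚ.+-monoʳ-≤ (approx x l)
  (subst (2^- k + 2^- l ≤_) (2^-halves j) (ℚₚ.+-mono-≤ (2^-antimono j<k) (2^-antimono j<l))))

2^-quarters : ∀ j → (2^- suc (suc j) + 2^- suc (suc j)) + (2^- suc (suc j) + 2^- suc (suc j)) ≡ 2^- j
2^-quarters j = trans (cong₂ _+_ (2^-halves (suc j)) (2^-halves (suc j))) (2^-halves j)

≤ᴿ⇒≼ : ∀ {x y} → x ≤ᴿ y → x ≼ y
within (≤ᴿ⇒≼ {x} {y} x≤y) j = N , λ {k} {l} N≤k N≤l → ≤-by-difference
    -- The budget 2^-j is cut into quarters: the two changes of index and the slack at `N` use one
    -- each, and `2^-nonneg` pads the fourth.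
    (ℚₚ.+-mono-≤ (ℚₚ.+-mono-≤ (approx-close-≥ x (2 ℕ.+ j) N≤k ℕₚ.≤-refl) (x≤y N))
                 (ℚₚ.+-mono-≤ (approx-close-≥ y (2 ℕ.+ j) ℕₚ.≤-refl N≤l) (2^-nonneg (2 ℕ.+ j))))
    (trans (cong (λ e → approx y l + e - approx x k) (sym (2^-quarters j)))
      (trans (lemma (approx x k) (approx x N) (approx y N) (approx y l) (2^- (2 ℕ.+ j)))
        (cong (λ e → ((approx x N + 2^- (2 ℕ.+ j)) + (approx y N + e)
                       + ((approx y l + 2^- (2 ℕ.+ j)) + 2^- (2 ℕ.+ j)))
                     - ((approx x k + approx x N) + (approx y N + 0ℚ)))
              (sym (2^-halves (2 ℕ.+ j))))))
  where
  N = 3 ℕ.+ j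
  lemma : ∀ xk xN yN yl e → (yl + ((e + e) + (e + e))) - xk
        ≡ ((xN + e) + (yN + e) + ((yl + e) + e)) - ((xk + xN) + (yN + 0ℚ))
  lemma = solve 5 (λ xk xN yN yl e → (yl :+ ((e :+ e) :+ (e :+ e))) :- xk
        := ((xN :+ e) :+ (yN :+ e) :+ ((yl :+ e) :+ e)) :- ((xk :+ xN) :+ (yN :+ con 0ℚ))) refl

-- The slack at the given n must come out as exactly two units 2^-n. A detour through a far index k
-- costs this much plus two units 2^-k and 2^-(j+1), and that surplus vanishes as j grows.
≼⇒≤ᴿ : ∀ {x y} → x ≼ y → x ≤ᴿ y
≼⇒≤ᴿ {x} {y} x≼y n = ≤-archimedean λ j → bound j (within x≼y (suc j))
  where
  lemma : ∀ xn xk yk yn en ek d → (yn + (en + en)) + (d + ((ek + ek))) - xn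
        ≡ ((xk + (en + ek)) + (yk + d) + (yn + (ek + en))) - ((xn + xk) + yk)
  lemma = solve 7 (λ xn xk yk yn en ek d → (yn :+ (en :+ en)) :+ (d :+ ((ek :+ ek))) :- xn
        := ((xk :+ (en :+ ek)) :+ (yk :+ d) :+ (yn :+ (ek :+ en))) :- ((xn :+ xk) :+ yk)) refl
  bound : ∀ j → x ≤[ 2^- suc j ] y →
          approx x n ≤ approx y n + (2^- n + 2^- n) + 2^- j
  bound j (N , h) = begin
    approx x n                                                      ≤⟨ ≤-by-difference
      (ℚₚ.+-mono-≤ (ℚₚ.+-mono-≤ (approx-close x n k) (h N≤k N≤k)) (approx-close y k n))
      (lemma (approx x n) (approx x k) (approx y k) (approx y n) (2^- n) (2^- k) (2^- suc j)) ⟩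
    approx y n + (2^- n + 2^- n) + (2^- suc j + (2^- k + 2^- k))    ≤⟨ ℚₚ.+-monoʳ-≤ (approx y n + (2^- n + 2^- n)) (ℚₚ.+-monoʳ-≤ (2^- suc j) (ℚₚ.+-mono-≤ small small)) ⟩
    approx y n + (2^- n + 2^- n) + (2^- suc j + (2^- (2 ℕ.+ j) + 2^- (2 ℕ.+ j)))
      ≡⟨ cong (λ e → approx y n + (2^- n + 2^- n) + e) (trans (cong (2^- suc j +_) (2^-halves (suc j))) (2^-halves j)) ⟩
    approx y n + (2^- n + 2^- n) + 2^- j                            ∎
    where
    open ℚₚ.≤-Reasoning
    k = N ℕ.⊔ (2 ℕ.+ j)
    N≤k = ℕₚ.m≤m⊔n N (2 ℕ.+ j)
    small : 2^- k ≤ 2^- (2 ℕ.+ j)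
    small = 2^-antimono (ℕₚ.m≤n⊔m N (2 ℕ.+ j))

≼-refl : ∀ {x} → x ≼ x
within (≼-refl {x}) j = suc j , approx-close-≥ x j

≼-trans : ∀ {x y z} → x ≼ y → y ≼ z → x ≼ z
within (≼-trans {x} {y} {z} p q) j with within p (suc j) | within q (suc j)
... | N , f | N′ , g = N ℕ.⊔ N′ , λ {k} {l} k≥ l≥ → begin
    approx x k                             ≤⟨ f (ℕₚ.≤-trans (ℕₚ.m≤m⊔n N N′) k≥) (ℕₚ.m≤m⊔n N N′) ⟩
    approx y (N ℕ.⊔ N′) + 2^- suc j        ≤⟨ ℚₚ.+-monoˡ-≤ (2^- suc j) (g (ℕₚ.m≤n⊔m N N′) (ℕₚ.≤-trans (ℕₚ.m≤n⊔m N N′) l≥)) ⟩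
    approx z l + 2^- suc j + 2^- suc j     ≡⟨ trans (ℚₚ.+-assoc (approx z l) (2^- suc j) (2^- suc j)) (cong (approx z l +_) (2^-halves j)) ⟩
    approx z l + 2^- j                     ∎
    where open ℚₚ.≤-Reasoning

≼-preorder : Preorder 0ℓ 0ℓ 0ℓ
≼-preorder = record
  { Carrier = ℝ ; _≈_ = _≡_ ; _≲_ = _≼_
  ; isPreorder = record { isEquivalence = isEquivalence ; reflexive = λ { refl → ≼-refl } ; trans = ≼-trans } }

module ≼-Reasoning = PreorderReasoning ≼-preorder

double-cancel-≤ : ∀ {p q} → p + p ≤ q + q → p ≤ q
double-cancel-≤ {p} {q} p+p≤q+q with p ℚₚ.≤? q
... | yes p≤q = p≤q
... | no  p≰q = ⊥-elim (<⇒≱ (ℚₚ.+-mono-< (ℚₚ.≰⇒> p≰q) (ℚₚ.≰⇒> p≰q)) p+p≤q+q)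

-- Opaque, since unification would otherwise compare the regularity proofs of sums.
infixl 6 _⊕_
opaque
  _⊕_ : ℝ → ℝ → ℝ
  _⊕_ = _+ᴿ_

opaque
  unfolding _⊕_

  ⊕-≼-+ᴿ : ∀ x y → x ⊕ y ≼ x +ᴿ y
  ⊕-≼-+ᴿ x y = ≼-refl {x +ᴿ y}

  +ᴿ-≼-⊕ : ∀ x y → x +ᴿ y ≼ x ⊕ y
  +ᴿ-≼-⊕ x y = ≼-refl {x +ᴿ y}

  ⊕-mono-≼ : ∀ {w x y z} → w ≼ x → y ≼ z → w ⊕ y ≼ x ⊕ z
  within (⊕-mono-≼ {w} {x} {y} {z} p q) j with within p (suc j) | within q (suc j)
  ... | N , f | N′ , g = N ℕ.⊔ N′ , λ {k} {l} k≥ l≥ →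
      subst (approx (w ⊕ y) k ≤_)
        (trans (lemma (approx x (suc l)) (approx z (suc l)) (2^- suc j)) (cong (approx (x ⊕ z) l +_) (2^-halves j)))
        (ℚₚ.+-mono-≤
          (f (ℕₚ.m≤n⇒m≤1+n (ℕₚ.≤-trans (ℕₚ.m≤m⊔n N N′) k≥)) (ℕₚ.m≤n⇒m≤1+n (ℕₚ.≤-trans (ℕₚ.m≤m⊔n N N′) l≥)))
          (g (ℕₚ.m≤n⇒m≤1+n (ℕₚ.≤-trans (ℕₚ.m≤n⊔m N N′) k≥)) (ℕₚ.m≤n⇒m≤1+n (ℕₚ.≤-trans (ℕₚ.m≤n⊔m N N′) l≥))))
    where
    lemma : ∀ a b e → (a + e) + (b + e) ≡ (a + b) + (e + e)
    lemma = solve 3 (λ a b e → (a :+ e) :+ (b :+ e) := (a :+ b) :+ (e :+ e)) refl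

  ⊕-comm-≼ : ∀ x y → x ⊕ y ≼ y ⊕ x
  within (⊕-comm-≼ x y) j = suc j , λ {k} {l} k≥ l≥ →
    subst (_≤ approx (y ⊕ x) l + 2^- j) (ℚₚ.+-comm (approx y (suc k)) (approx x (suc k)))
      (approx-close-≥ (y ⊕ x) j k≥ l≥)

  ⊕-assoc-≼ : ∀ x y z → (x ⊕ y) ⊕ z ≼ x ⊕ (y ⊕ z)
  within (⊕-assoc-≼ x y z) j = 3 ℕ.+ j , λ {k} {l} k≥ l≥ → ≤-by-difference
      (ℚₚ.+-mono-≤
        (ℚₚ.+-mono-≤ (approx-close-≥ x (2 ℕ.+ j) (ℕₚ.m≤n⇒m≤1+n (ℕₚ.m≤n⇒m≤1+n k≥)) (ℕₚ.m≤n⇒m≤1+n l≥))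
                     (approx-close-≥ y (2 ℕ.+ j) (ℕₚ.m≤n⇒m≤1+n (ℕₚ.m≤n⇒m≤1+n k≥)) (ℕₚ.m≤n⇒m≤1+n (ℕₚ.m≤n⇒m≤1+n l≥))))
        (ℚₚ.+-mono-≤ (approx-close-≥ z (2 ℕ.+ j) (ℕₚ.m≤n⇒m≤1+n k≥) (ℕₚ.m≤n⇒m≤1+n (ℕₚ.m≤n⇒m≤1+n l≥)))
                     (2^-nonneg (2 ℕ.+ j))))
      (trans (cong (λ e → approx (x ⊕ (y ⊕ z)) l + e - approx ((x ⊕ y) ⊕ z) k) (sym (2^-quarters j)))
             (lemma (approx x (2 ℕ.+ k)) (approx y (2 ℕ.+ k)) (approx z (suc k))
                    (approx x (suc l)) (approx y (2 ℕ.+ l)) (approx z (2 ℕ.+ l)) (2^- (2 ℕ.+ j))))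
    where
    lemma : ∀ a b c a′ b′ c′ e → (a′ + (b′ + c′)) + ((e + e) + (e + e)) - ((a + b) + c)
          ≡ ((a′ + e) + (b′ + e) + ((c′ + e) + e)) - ((a + b) + (c + 0ℚ))
    lemma = solve 7 (λ a b c a′ b′ c′ e → (a′ :+ (b′ :+ c′)) :+ ((e :+ e) :+ (e :+ e)) :- ((a :+ b) :+ c)
          := ((a′ :+ e) :+ (b′ :+ e) :+ ((c′ :+ e) :+ e)) :- ((a :+ b) :+ (c :+ con 0ℚ))) refl

  ⊕-identityʳ-≼ : ∀ x → x ⊕ 0ᴿ ≼ x
  within (⊕-identityʳ-≼ x) j = suc j , λ {k} {l} k≥ l≥ →
    subst (_≤ approx x l + 2^- j) (sym (ℚₚ.+-identityʳ (approx x (suc k)))) (approx-close-≥ x j (ℕₚ.m≤n⇒m≤1+n k≥) l≥)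

  ⊕-identityʳ-≽ : ∀ x → x ≼ x ⊕ 0ᴿ
  within (⊕-identityʳ-≽ x) j = suc j , λ {k} {l} k≥ l≥ →
    subst (λ s → approx x k ≤ s + 2^- j) (sym (ℚₚ.+-identityʳ (approx x (suc l)))) (approx-close-≥ x j k≥ (ℕₚ.m≤n⇒m≤1+n l≥))

  ⊕-cancelʳ-≼ : ∀ z {x y} → x ⊕ z ≼ y ⊕ z → x ≼ y
  within (⊕-cancelʳ-≼ z {x} {y} p) j with within p (suc j)
  -- A sum at index k reads its terms at `suc k`, so the indices at which x and y are compared are
  -- taken apart as successors.
  ... | N , f = suc (N ℕ.⊔ suc j) , λ { {suc k} {suc l} (ℕ.s≤s k≥) (ℕ.s≤s l≥) → ≤-by-difference
      (ℚₚ.+-mono-≤ (f (ℕₚ.≤-trans (ℕₚ.m≤m⊔n N (suc j)) k≥) (ℕₚ.≤-trans (ℕₚ.m≤m⊔n N (suc j)) l≥))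
                   (approx-close-≥ z (suc j) (ℕ.s≤s (ℕₚ.≤-trans (ℕₚ.m≤n⊔m N (suc j)) l≥)) (ℕ.s≤s (ℕₚ.≤-trans (ℕₚ.m≤n⊔m N (suc j)) k≥))))
      (trans (cong (λ e → approx y (suc l) + e - approx x (suc k)) (sym (2^-halves j)))
             (lemma (approx x (suc k)) (approx z (suc k)) (approx y (suc l)) (approx z (suc l)) (2^- suc j))) }
    where
    lemma : ∀ xk zk yl zl e → (yl + (e + e)) - xk ≡ (((yl + zl) + e) + (zk + e)) - ((xk + zk) + zl)
    lemma = solve 5 (λ xk zk yl zl e → (yl :+ (e :+ e)) :- xk := (((yl :+ zl) :+ e) :+ (zk :+ e)) :- ((xk :+ zk) :+ zl)) refl

  ≼-archimedean : ∀ {x y} → (∀ j → x ≼ y ⊕ fromℚ (2^- j)) → x ≼ y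
  within (≼-archimedean {x} {y} h) j with within (h (suc j)) (suc j)
  ... | N , f = suc N , λ { {suc k} {suc l} (ℕ.s≤s k≥) (ℕ.s≤s l≥) →
      subst (approx x (suc k) ≤_)
        (trans (ℚₚ.+-assoc (approx y (suc l)) (2^- suc j) (2^- suc j)) (cong (approx y (suc l) +_) (2^-halves j)))
        (f (ℕₚ.m≤n⇒m≤1+n k≥) l≥) }

  -- Stands in for division by two. The error is not even halved, which is harmless because 2^-j is
  -- below its own double.
  double-cancel-≼ : ∀ {x y} → x ⊕ x ≼ y ⊕ y → x ≼ y
  within (double-cancel-≼ {x} {y} p) j with within p j
  ... | N , f = suc N , λ { {suc k} {suc l} (ℕ.s≤s k≥) (ℕ.s≤s l≥) → halve (approx x (suc k)) (approx y (suc l)) (f k≥ l≥) }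
    where
    lemma : ∀ b e → (b + e) + (b + e) ≡ ((b + b) + e) + e
    lemma = solve 2 (λ b e → (b :+ e) :+ (b :+ e) := ((b :+ b) :+ e) :+ e) refl
    halve : ∀ a b → a + a ≤ b + b + 2^- j → a ≤ b + 2^- j
    halve a b q = double-cancel-≤ (begin
      a + a                                  ≤⟨ q ⟩
      b + b + 2^- j                          ≡⟨ ℚₚ.+-identityʳ (b + b + 2^- j) ⟨
      b + b + 2^- j + 0ℚ                     ≤⟨ ℚₚ.+-monoʳ-≤ (b + b + 2^- j) (2^-nonneg j) ⟩
      b + b + 2^- j + 2^- j                  ≡⟨ lemma b (2^- j) ⟨
      (b + 2^- j) + (b + 2^- j)              ∎)
      where open ℚₚ.≤-Reasoning

  fromℚ-homo-+-≼ : ∀ p q → fromℚ (p + q) ≼ fromℚ p ⊕ fromℚ q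
  within (fromℚ-homo-+-≼ p q) = within (≼-refl {fromℚ (p + q)})

  fromℚ-homo-+-≽ : ∀ p q → fromℚ p ⊕ fromℚ q ≼ fromℚ (p + q)
  within (fromℚ-homo-+-≽ p q) = within (≼-refl {fromℚ (p + q)})

⊕-assoc-≽ : ∀ x y z → x ⊕ (y ⊕ z) ≼ (x ⊕ y) ⊕ z
⊕-assoc-≽ x y z = begin
  x ⊕ (y ⊕ z)   ≲⟨ ⊕-comm-≼ x (y ⊕ z) ⟩
  (y ⊕ z) ⊕ x   ≲⟨ ⊕-assoc-≼ y z x ⟩
  y ⊕ (z ⊕ x)   ≲⟨ ⊕-comm-≼ y (z ⊕ x) ⟩
  (z ⊕ x) ⊕ y   ≲⟨ ⊕-assoc-≼ z x y ⟩
  z ⊕ (x ⊕ y)   ≲⟨ ⊕-comm-≼ z (x ⊕ y) ⟩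
  (x ⊕ y) ⊕ z   ∎
  where open ≼-Reasoning

⊕-medial-≼ : ∀ w x y z → (w ⊕ x) ⊕ (y ⊕ z) ≼ (w ⊕ y) ⊕ (x ⊕ z)
⊕-medial-≼ w x y z = begin
  (w ⊕ x) ⊕ (y ⊕ z)   ≲⟨ ⊕-assoc-≼ w x (y ⊕ z) ⟩
  w ⊕ (x ⊕ (y ⊕ z))   ≲⟨ ⊕-mono-≼ ≼-refl (⊕-assoc-≽ x y z) ⟩
  w ⊕ ((x ⊕ y) ⊕ z)   ≲⟨ ⊕-mono-≼ ≼-refl (⊕-mono-≼ (⊕-comm-≼ x y) ≼-refl) ⟩
  w ⊕ ((y ⊕ x) ⊕ z)   ≲⟨ ⊕-mono-≼ ≼-refl (⊕-assoc-≼ y x z) ⟩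
  w ⊕ (y ⊕ (x ⊕ z))   ≲⟨ ⊕-assoc-≽ w y (x ⊕ z) ⟩
  (w ⊕ y) ⊕ (x ⊕ z)   ∎
  where open ≼-Reasoning

⊕-identityˡ-≼ : ∀ x → 0ᴿ ⊕ x ≼ x
⊕-identityˡ-≼ x = ≼-trans (⊕-comm-≼ 0ᴿ x) (⊕-identityʳ-≼ x)

⊕-identityˡ-≽ : ∀ x → x ≼ 0ᴿ ⊕ x
⊕-identityˡ-≽ x = ≼-trans (⊕-identityʳ-≽ x) (⊕-comm-≼ x 0ᴿ)

fromℚ-mono-≼ : ∀ {p q} → p ≤ q → fromℚ p ≼ fromℚ q
within (fromℚ-mono-≼ {p} {q} p≤q) j = 0 , λ _ _ →
  subst (_≤ q + 2^- j) (ℚₚ.+-identityʳ p) (ℚₚ.+-mono-≤ p≤q (2^-nonneg j))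

fromℚ-cancel-≼ : ∀ {p q} → fromℚ p ≼ fromℚ q → p ≤ q
fromℚ-cancel-≼ {p} {q} h = ≤-archimedean λ j →
  proj₂ (within h j) ℕₚ.≤-refl ℕₚ.≤-refl

opaque
  Σ< : (ℕ → ℝ) → ℕ → ℝ
  Σ< = partialSum

opaque
  unfolding Σ<

  Σ<-≼-partialSum : ∀ s n → Σ< s n ≼ partialSum s n
  Σ<-≼-partialSum s n = ≼-refl {partialSum s n}

  partialSum-≼-Σ< : ∀ s n → partialSum s n ≼ Σ< s n
  partialSum-≼-Σ< s n = ≼-refl {partialSum s n}

  Σ<-zero-≼ : ∀ s → Σ< s 0 ≼ 0ᴿ
  Σ<-zero-≼ s = ≼-refl {0ᴿ}

  Σ<-zero-≽ : ∀ s → 0ᴿ ≼ Σ< s 0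
  Σ<-zero-≽ s = ≼-refl {0ᴿ}

  Σ<-suc-≼ : ∀ s n → Σ< s (suc n) ≼ Σ< s n ⊕ s n
  Σ<-suc-≼ s n = +ᴿ-≼-⊕ (partialSum s n) (s n)

  Σ<-suc-≽ : ∀ s n → Σ< s n ⊕ s n ≼ Σ< s (suc n)
  Σ<-suc-≽ s n = ⊕-≼-+ᴿ (partialSum s n) (s n)

-- If `≤ᴿ` fails at one index n, the approximations there differ by more than two units 2^-n, which
-- is what regularity consumes on the way from n to an arbitrary k.
⋠⇒≽ : ExcludedMiddle 0ℓ → ∀ {x y} → ¬ x ≼ y → y ≼ x
⋠⇒≽ em {x} {y} x⋠y = ≤ᴿ⇒≼ (compare em)
  where
  lemma : ∀ xn xk yn yk en ek → (xk + (ek + ek)) - yk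
        ≡ (((yn + (ek + en)) + (xk + (en + ek))) + xn) - ((yk + xn) + (yn + (en + en)))
  lemma = solve 6 (λ xn xk yn yk en ek → (xk :+ (ek :+ ek)) :- yk
        := (((yn :+ (ek :+ en)) :+ (xk :+ (en :+ ek))) :+ xn) :- ((yk :+ xn) :+ (yn :+ (en :+ en)))) refl
  compare : Dec (∃ λ n → ¬ approx x n ≤ approx y n + (2^- n + 2^- n)) → y ≤ᴿ x
  compare (no  none)     = ⊥-elim (x⋠y (≤ᴿ⇒≼ λ n → decidable-stable (approx x n ℚₚ.≤? approx y n + (2^- n + 2^- n)) (λ ¬p → none (n , ¬p))))
  compare (yes (n , ¬p)) k = ≤-by-difference
    (ℚₚ.+-mono-≤ (ℚₚ.+-mono-≤ (approx-close y k n) (approx-close x n k)) (ℚₚ.<⇒≤ (ℚₚ.≰⇒> ¬p)))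
    (lemma (approx x n) (approx x k) (approx y n) (approx y k) (2^- n) (2^- k))

-- Converts strictness into a dyadic margin, which approximations of finite precision can detect.
⋠⇒gap : ExcludedMiddle 0ℓ → ∀ {x y} → ¬ x ≼ y → ∃ λ j → y ⊕ fromℚ (2^- j) ≼ x
⋠⇒gap em {x} {y} x⋠y with em {∃ λ j → ¬ x ≼ y ⊕ fromℚ (2^- j)}
... | yes (j , ¬p) = j , ⋠⇒≽ em ¬p
... | no  none     = ⊥-elim (x⋠y (≼-archimedean λ j → decidable-stable em (λ ¬p → none (j , ¬p))))

-- Measures

infixl 6 _∪_ _∖_
infixl 7 _∩_

pair : Borel → Borel → ℕ → Borel
pair A B zero          = A
pair A B (suc zero)    = B
pair A B (suc (suc _)) = empty

_∪_ _∩_ _∖_ : Borel → Borel → Borel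
A ∪ B = ⋃ pair A B
A ∩ B = ∁ (∁ A ∪ ∁ B)
A ∖ B = A ∩ ∁ B

⋃< : (ℕ → Borel) → ℕ → Borel
⋃< A zero    = empty
⋃< A (suc n) = ⋃< A n ∪ A n

∪⁺ˡ : ∀ {A B ω} → ω ∈ ⟦ A ⟧ → ω ∈ ⟦ A ∪ B ⟧
∪⁺ˡ a = 0 , a

∪⁺ʳ : ∀ {A B ω} → ω ∈ ⟦ B ⟧ → ω ∈ ⟦ A ∪ B ⟧
∪⁺ʳ b = 1 , b

∪⁻ : ∀ {A B ω} → ω ∈ ⟦ A ∪ B ⟧ → ω ∈ ⟦ A ⟧ ⊎ ω ∈ ⟦ B ⟧
∪⁻ (0 , a)           = inj₁ a
∪⁻ (1 , b)           = inj₂ b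
∪⁻ (suc (suc _) , e) = ⊥-elim (e tt)

∪-mono : ∀ {A B C D} → ⟦ A ⟧ ⊆ ⟦ C ⟧ → ⟦ B ⟧ ⊆ ⟦ D ⟧ → ⟦ A ∪ B ⟧ ⊆ ⟦ C ∪ D ⟧
∪-mono {C = C} {D} f g = [ ∪⁺ˡ {C} {D} ∘ f , ∪⁺ʳ {C} {D} ∘ g ]′ ∘ ∪⁻

∩⁺ : ∀ {A B ω} → ω ∈ ⟦ A ⟧ → ω ∈ ⟦ B ⟧ → ω ∈ ⟦ A ∩ B ⟧
∩⁺ {A} {B} a b = [ (λ ¬a → ¬a a) , (λ ¬b → ¬b b) ]′ ∘ ∪⁻ {∁ A} {∁ B}

∖⁻ʳ : ∀ {A B ω} → ω ∈ ⟦ A ∖ B ⟧ → ¬ ω ∈ ⟦ B ⟧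
∖⁻ʳ {A} {B} p b = p (∪⁺ʳ {∁ A} {∁ (∁ B)} λ ¬b → ¬b b)

⋃<⁺ : ∀ {A ω i} n → i ℕ.< n → ω ∈ ⟦ A i ⟧ → ω ∈ ⟦ ⋃< A n ⟧
⋃<⁺ {A} (suc n) (ℕ.s≤s i≤n) a with ℕₚ.m≤n⇒m<n∨m≡n i≤n
... | inj₁ i<n  = ∪⁺ˡ {⋃< A n} {A n} (⋃<⁺ n i<n a)
... | inj₂ refl = ∪⁺ʳ {⋃< A n} {A n} a

⋃<⊆⋃ : ∀ A n → ⟦ ⋃< A n ⟧ ⊆ ⟦ ⋃ A ⟧
⋃<⊆⋃ A zero    e = ⊥-elim (e tt)
⋃<⊆⋃ A (suc n) p = [ ⋃<⊆⋃ A n , (λ a → n , a) ]′ (∪⁻ p)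

-- Countable additivity is equivalent to finite additivity together with continuity, and the
-- latter form passes more easily to sums and restrictions.
record FiniteMeasure : Set where
  field
    ∣_∣ᴹ       : Borel → ℝ
    extend     : ∀ {A B} → ⟦ A ⟧ ≐ ⟦ B ⟧ → ∣ A ∣ᴹ ≼ ∣ B ∣ᴹ
    0≼         : ∀ A → 0ᴿ ≼ ∣ A ∣ᴹ
    empty≼0    : ∣ empty ∣ᴹ ≼ 0ᴿ
    additive-≼ : ∀ {A B} → ⟦ A ⟧ ⊥ ⟦ B ⟧ → ∣ A ∪ B ∣ᴹ ≼ ∣ A ∣ᴹ ⊕ ∣ B ∣ᴹ
    additive-≽ : ∀ {A B} → ⟦ A ⟧ ⊥ ⟦ B ⟧ → ∣ A ∣ᴹ ⊕ ∣ B ∣ᴹ ≼ ∣ A ∪ B ∣ᴹ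
    continuous : ∀ A j → ∃ λ N → ∣ ⋃ A ∖ ⋃< A N ∣ᴹ ≼ fromℚ (2^- j)

open FiniteMeasure

module _ (em : ExcludedMiddle 0ℓ) where

  ∩⁻ˡ : ∀ {A B ω} → ω ∈ ⟦ A ∩ B ⟧ → ω ∈ ⟦ A ⟧
  ∩⁻ˡ {A} {B} p = decidable-stable em λ ¬a → p (∪⁺ˡ {∁ A} {∁ B} ¬a)

  ∩⁻ʳ : ∀ {A B ω} → ω ∈ ⟦ A ∩ B ⟧ → ω ∈ ⟦ B ⟧
  ∩⁻ʳ {A} {B} p = decidable-stable em λ ¬b → p (∪⁺ʳ {∁ A} {∁ B} ¬b)

  ∩-mono : ∀ {A B C D} → ⟦ A ⟧ ⊆ ⟦ C ⟧ → ⟦ B ⟧ ⊆ ⟦ D ⟧ → ⟦ A ∩ B ⟧ ⊆ ⟦ C ∩ D ⟧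
  ∩-mono {A} {B} {C} {D} f g p = ∩⁺ {C} {D} (f (∩⁻ˡ {A} {B} p)) (g (∩⁻ʳ {A} {B} p))

  ∪-∖-≐ : ∀ A B → ⟦ A ∪ (B ∖ A) ⟧ ≐ ⟦ A ∪ B ⟧
  ∪-∖-≐ A B = ∪-mono {A} {B ∖ A} {A} {B} id (∩⁻ˡ {B} {∁ A}) , λ {ω} p → back em (∪⁻ p)
    where
    back : ∀ {ω} → Dec (ω ∈ ⟦ A ⟧) → ω ∈ ⟦ A ⟧ ⊎ ω ∈ ⟦ B ⟧ → ω ∈ ⟦ A ∪ (B ∖ A) ⟧
    back (yes a) _        = ∪⁺ˡ {A} {B ∖ A} a
    back (no ¬a) (inj₁ a) = ⊥-elim (¬a a)
    back (no ¬a) (inj₂ b) = ∪⁺ʳ {A} {B ∖ A} (∩⁺ {B} {∁ A} b ¬a)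

  ∖-⊥ : ∀ A B → ⟦ A ⟧ ⊥ ⟦ B ∖ A ⟧
  ∖-⊥ A B (a , p) = ∖⁻ʳ {B} {A} p a

  ∖-split : ∀ A B → ⟦ A ⟧ ⊆ ⟦ B ⟧ → ⟦ A ∪ (B ∖ A) ⟧ ≐ ⟦ B ⟧
  ∖-split A B A⊆B =
    [ A⊆B , id ]′ ∘ ∪⁻ ∘ proj₁ (∪-∖-≐ A B) , λ b → proj₂ (∪-∖-≐ A B) (∪⁺ʳ {A} {B} b)

  module _ (M : FiniteMeasure) where

    measure-mono : ∀ {A B} → ⟦ A ⟧ ⊆ ⟦ B ⟧ → ∣ M ∣ᴹ A ≼ ∣ M ∣ᴹ B
    measure-mono {A} {B} A⊆B = begin
      ∣ M ∣ᴹ A                     ≲⟨ ⊕-identityʳ-≽ _ ⟩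
      ∣ M ∣ᴹ A ⊕ 0ᴿ                ≲⟨ ⊕-mono-≼ ≼-refl (0≼ M (B ∖ A)) ⟩
      ∣ M ∣ᴹ A ⊕ ∣ M ∣ᴹ (B ∖ A)    ≲⟨ additive-≽ M (∖-⊥ A B) ⟩
      ∣ M ∣ᴹ (A ∪ (B ∖ A))         ≲⟨ extend M (∖-split A B A⊆B) ⟩
      ∣ M ∣ᴹ B                     ∎
      where open ≼-Reasoning

    subadditive : ∀ A B → ∣ M ∣ᴹ (A ∪ B) ≼ ∣ M ∣ᴹ A ⊕ ∣ M ∣ᴹ B
    subadditive A B = begin
      ∣ M ∣ᴹ (A ∪ B)               ≲⟨ measure-mono (proj₂ (∪-∖-≐ A B)) ⟩
      ∣ M ∣ᴹ (A ∪ (B ∖ A))         ≲⟨ additive-≼ M (∖-⊥ A B) ⟩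
      ∣ M ∣ᴹ A ⊕ ∣ M ∣ᴹ (B ∖ A)    ≲⟨ ⊕-mono-≼ ≼-refl (measure-mono (∩⁻ˡ {B} {∁ A})) ⟩
      ∣ M ∣ᴹ A ⊕ ∣ M ∣ᴹ B          ∎
      where open ≼-Reasoning

    -- Continuity from below: what a finite union misses has measure at most 2^-j, for any j.
    measure-⋃-≼ : ∀ A {x} → (∀ n → ∣ M ∣ᴹ (⋃< A n) ≼ x) → ∣ M ∣ᴹ (⋃ A) ≼ x
    measure-⋃-≼ A {x} h = ≼-archimedean λ j → bound j (continuous M A j)
      where
      open ≼-Reasoning
      bound : ∀ j → (∃ λ N → ∣ M ∣ᴹ (⋃ A ∖ ⋃< A N) ≼ fromℚ (2^- j)) → ∣ M ∣ᴹ (⋃ A) ≼ x ⊕ fromℚ (2^- j)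
      bound j (N , small) = begin
        ∣ M ∣ᴹ (⋃ A)                                     ≲⟨ measure-mono (proj₂ (∖-split (⋃< A N) (⋃ A) (⋃<⊆⋃ A N))) ⟩
        ∣ M ∣ᴹ (⋃< A N ∪ (⋃ A ∖ ⋃< A N))                 ≲⟨ subadditive (⋃< A N) (⋃ A ∖ ⋃< A N) ⟩
        ∣ M ∣ᴹ (⋃< A N) ⊕ ∣ M ∣ᴹ (⋃ A ∖ ⋃< A N)          ≲⟨ ⊕-mono-≼ (h N) small ⟩
        x ⊕ fromℚ (2^- j)                                ∎

    Null : Borel → Set
    Null A = ∣ M ∣ᴹ A ≼ 0ᴿ

    null-∪ : ∀ A B → Null A → Null B → Null (A ∪ B)
    null-∪ A B a b = begin
      ∣ M ∣ᴹ (A ∪ B)        ≲⟨ subadditive A B ⟩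
      ∣ M ∣ᴹ A ⊕ ∣ M ∣ᴹ B   ≲⟨ ⊕-mono-≼ a b ⟩
      0ᴿ ⊕ 0ᴿ               ≲⟨ ⊕-identityʳ-≼ 0ᴿ ⟩
      0ᴿ                    ∎
      where open ≼-Reasoning

    null-⋃ : ∀ A → (∀ n → Null (A n)) → Null (⋃ A)
    null-⋃ A h = measure-⋃-≼ A finite
      where
      finite : ∀ n → Null (⋃< A n)
      finite zero    = empty≼0 M
      finite (suc n) = null-∪ (⋃< A n) (A n) (finite n) (h n)

  infixl 6 _⊞_
  -- Sums serve two ends: repeated doubling yields 2ⁿ μ, and a set that is small for a sum is small
  -- for both summands.
  _⊞_ : FiniteMeasure → FiniteMeasure → FiniteMeasure
  M ⊞ M′ = record
    { ∣_∣ᴹ       = λ A → ∣ M ∣ᴹ A ⊕ ∣ M′ ∣ᴹ A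
    ; extend     = λ A≐B → ⊕-mono-≼ (extend M A≐B) (extend M′ A≐B)
    ; 0≼         = λ A → ≼-trans (⊕-identityʳ-≽ 0ᴿ) (⊕-mono-≼ (0≼ M A) (0≼ M′ A))
    ; empty≼0    = ≼-trans (⊕-mono-≼ (empty≼0 M) (empty≼0 M′)) (⊕-identityʳ-≼ 0ᴿ)
    ; additive-≼ = λ A⊥B → ≼-trans (⊕-mono-≼ (additive-≼ M A⊥B) (additive-≼ M′ A⊥B)) (⊕-medial-≼ _ _ _ _)
    ; additive-≽ = λ A⊥B → ≼-trans (⊕-medial-≼ _ _ _ _) (⊕-mono-≼ (additive-≽ M A⊥B) (additive-≽ M′ A⊥B))
    ; continuous = λ A j → combine A j (continuous M A (suc j)) (continuous M′ A (suc j))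
    }
    where
    ⋃<-mono : ∀ A {m n} → m ℕ.≤′ n → ⟦ ⋃< A m ⟧ ⊆ ⟦ ⋃< A n ⟧
    ⋃<-mono A ℕ.≤′-refl           p = p
    ⋃<-mono A (ℕ.≤′-step {n} m≤n) p = ∪⁺ˡ {⋃< A n} {A n} (⋃<-mono A m≤n p)
    shrink : ∀ A {m n} → m ℕ.≤ n → ⟦ ⋃ A ∖ ⋃< A n ⟧ ⊆ ⟦ ⋃ A ∖ ⋃< A m ⟧
    shrink A {m} {n} m≤n =
      ∩-mono {⋃ A} {∁ ⋃< A n} {⋃ A} {∁ ⋃< A m} id (λ ¬p p → ¬p (⋃<-mono A (ℕₚ.≤⇒≤′ m≤n) p))
    combine : ∀ A j → (∃ λ N → ∣ M ∣ᴹ (⋃ A ∖ ⋃< A N) ≼ fromℚ (2^- suc j)) →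
                      (∃ λ N → ∣ M′ ∣ᴹ (⋃ A ∖ ⋃< A N) ≼ fromℚ (2^- suc j)) →
              ∃ λ N → ∣ M ∣ᴹ (⋃ A ∖ ⋃< A N) ⊕ ∣ M′ ∣ᴹ (⋃ A ∖ ⋃< A N) ≼ fromℚ (2^- j)
    combine A j (N , p) (N′ , p′) = N ℕ.⊔ N′ , (begin
      ∣ M ∣ᴹ (⋃ A ∖ ⋃< A (N ℕ.⊔ N′)) ⊕ ∣ M′ ∣ᴹ (⋃ A ∖ ⋃< A (N ℕ.⊔ N′))
        ≲⟨ ⊕-mono-≼ (measure-mono M (shrink A (ℕₚ.m≤m⊔n N N′))) (measure-mono M′ (shrink A (ℕₚ.m≤n⊔m N N′))) ⟩
      ∣ M ∣ᴹ (⋃ A ∖ ⋃< A N) ⊕ ∣ M′ ∣ᴹ (⋃ A ∖ ⋃< A N′)  ≲⟨ ⊕-mono-≼ p p′ ⟩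
      fromℚ (2^- suc j) ⊕ fromℚ (2^- suc j)            ≲⟨ fromℚ-homo-+-≽ (2^- suc j) (2^- suc j) ⟩
      fromℚ (2^- suc j + 2^- suc j)                    ≡⟨ cong fromℚ (2^-halves j) ⟩
      fromℚ (2^- j)                                    ∎)
      where open ≼-Reasoning

  -- Restriction to a complement turns an estimate off an open set into a comparison of two
  -- measures, which can be checked on cylinders.
  restrict : FiniteMeasure → Borel → FiniteMeasure
  restrict M V = record
    { ∣_∣ᴹ       = λ A → ∣ M ∣ᴹ (A ∩ V)
    ; extend     = λ {A} {B} (A⊆B , _) → measure-mono M (∩-mono {A} {V} {B} {V} A⊆B id)
    ; 0≼         = λ A → 0≼ M (A ∩ V)
    ; empty≼0    = ≼-trans (measure-mono M (∩⁻ˡ {empty} {V})) (empty≼0 M)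
    ; additive-≼ = λ {A} {B} A⊥B → ≼-trans (measure-mono M (proj₁ (distrib A B))) (additive-≼ M (disjoint A B A⊥B))
    ; additive-≽ = λ {A} {B} A⊥B → ≼-trans (additive-≽ M (disjoint A B A⊥B)) (measure-mono M (proj₂ (distrib A B)))
    ; continuous = λ A j → proj₁ (continuous M A j) ,
        ≼-trans (measure-mono M (∩⁻ˡ {⋃ A ∖ ⋃< A (proj₁ (continuous M A j))} {V})) (proj₂ (continuous M A j))
    }
    where
    disjoint : ∀ A B → ⟦ A ⟧ ⊥ ⟦ B ⟧ → ⟦ A ∩ V ⟧ ⊥ ⟦ B ∩ V ⟧
    disjoint A B A⊥B (p , q) = A⊥B (∩⁻ˡ {A} {V} p , ∩⁻ˡ {B} {V} q)
    distrib : ∀ A B → ⟦ (A ∪ B) ∩ V ⟧ ≐ ⟦ A ∩ V ∪ B ∩ V ⟧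
    distrib A B =
      (λ p → [ (λ a → ∪⁺ˡ {A ∩ V} {B ∩ V} (∩⁺ {A} {V} a (∩⁻ʳ {A ∪ B} {V} p)))
             , (λ b → ∪⁺ʳ {A ∩ V} {B ∩ V} (∩⁺ {B} {V} b (∩⁻ʳ {A ∪ B} {V} p))) ]′ (∪⁻ (∩⁻ˡ {A ∪ B} {V} p))) ,
      [ ∩-mono {A} {V} {A ∪ B} {V} (∪⁺ˡ {A} {B}) id , ∩-mono {B} {V} {A ∪ B} {V} (∪⁺ʳ {A} {B}) id ]′ ∘ ∪⁻

  -- Finite additivity and continuity of probability measures

  module _ (ν : ProbabilityMeasure) where
    private
      m = measure ν

      m-extend : ∀ {A B} → ⟦ A ⟧ ≐ ⟦ B ⟧ → m A ≼ m B
      m-extend {A} {B} A≐B = ≤ᴿ⇒≼ (proj₁ (extensional ν A B A≐B))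

      m-empty : m empty ≼ 0ᴿ
      m-empty = ≤ᴿ⇒≼ (proj₁ (null-empty ν))

      m-nonneg : ∀ A → 0ᴿ ≼ m A
      m-nonneg A = ≤ᴿ⇒≼ (nonneg ν A)

      sum-⋃ : ∀ A → (∀ i j → i ≢ j → ⟦ A i ⟧ ⊥ ⟦ A j ⟧) → ∀ j → ∃ λ N → ∀ n → N ℕ.≤ n →
              Σ< (m ∘ A) n ≼ m (⋃ A) ⊕ fromℚ (2^- j) × m (⋃ A) ≼ Σ< (m ∘ A) n ⊕ fromℚ (2^- j)
      sum-⋃ A A⊥ j with σ-additive ν A A⊥ (2^- j) (2^-positive j)
      ... | N , h = N , λ n N≤n → 
          ≼-trans (Σ<-≼-partialSum (m ∘ A) n) (≼-trans (≤ᴿ⇒≼ (proj₁ (h n N≤n))) (+ᴿ-≼-⊕ (m (⋃ A)) (fromℚ (2^- j)))) ,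
          ≼-trans (≤ᴿ⇒≼ (proj₂ (h n N≤n))) (≼-trans (+ᴿ-≼-⊕ (partialSum (m ∘ A) n) (fromℚ (2^- j)))
            (⊕-mono-≼ (partialSum-≼-Σ< (m ∘ A) n) ≼-refl))

      pair-⊥ : ∀ {A B} → ⟦ A ⟧ ⊥ ⟦ B ⟧ → ∀ i j → i ≢ j → ⟦ pair A B i ⟧ ⊥ ⟦ pair A B j ⟧
      pair-⊥ A⊥B 0             0             i≢j _       = i≢j refl
      pair-⊥ A⊥B 0             1             i≢j p       = A⊥B p
      pair-⊥ A⊥B 1             0             i≢j (b , a) = A⊥B (a , b)
      pair-⊥ A⊥B 1             1             i≢j _       = i≢j refl
      pair-⊥ A⊥B (suc (suc _)) _             i≢j (e , _) = e tt
      pair-⊥ A⊥B 0             (suc (suc _)) i≢j (_ , e) = e tt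
      pair-⊥ A⊥B 1             (suc (suc _)) i≢j (_ , e) = e tt

      module _ (A B : Borel) where
        s = m ∘ pair A B

        sum-pair-≼ : ∀ n → Σ< s (2 ℕ.+ n) ≼ m A ⊕ m B
        sum-pair-≼ zero    = begin
          Σ< s 2                ≲⟨ Σ<-suc-≼ s 1 ⟩
          Σ< s 1 ⊕ m B          ≲⟨ ⊕-mono-≼ (Σ<-suc-≼ s 0) ≼-refl ⟩
          Σ< s 0 ⊕ m A ⊕ m B    ≲⟨ ⊕-mono-≼ (⊕-mono-≼ (Σ<-zero-≼ s) ≼-refl) ≼-refl ⟩
          0ᴿ ⊕ m A ⊕ m B                ≲⟨ ⊕-mono-≼ (⊕-identityˡ-≼ (m A)) ≼-refl ⟩
          m A ⊕ m B                     ∎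
          where open ≼-Reasoning
        sum-pair-≼ (suc n) = begin
          Σ< s (3 ℕ.+ n)              ≲⟨ Σ<-suc-≼ s (2 ℕ.+ n) ⟩
          Σ< s (2 ℕ.+ n) ⊕ m empty    ≲⟨ ⊕-mono-≼ (sum-pair-≼ n) m-empty ⟩
          m A ⊕ m B ⊕ 0ᴿ                      ≲⟨ ⊕-identityʳ-≼ (m A ⊕ m B) ⟩
          m A ⊕ m B                           ∎
          where open ≼-Reasoning

        sum-pair-≽ : ∀ n → m A ⊕ m B ≼ Σ< s (2 ℕ.+ n)
        sum-pair-≽ zero    = begin
          m A ⊕ m B                     ≲⟨ ⊕-mono-≼ (⊕-identityˡ-≽ (m A)) ≼-refl ⟩
          0ᴿ ⊕ m A ⊕ m B                ≲⟨ ⊕-mono-≼ (⊕-mono-≼ (Σ<-zero-≽ s) ≼-refl) ≼-refl ⟩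
          Σ< s 0 ⊕ m A ⊕ m B            ≲⟨ ⊕-mono-≼ (Σ<-suc-≽ s 0) ≼-refl ⟩
          Σ< s 1 ⊕ m B          ≲⟨ Σ<-suc-≽ s 1 ⟩
          Σ< s 2                ∎
          where open ≼-Reasoning
        sum-pair-≽ (suc n) = begin
          m A ⊕ m B                           ≲⟨ ⊕-identityʳ-≽ (m A ⊕ m B) ⟩
          m A ⊕ m B ⊕ 0ᴿ                      ≲⟨ ⊕-mono-≼ (sum-pair-≽ n) (m-nonneg empty) ⟩
          Σ< s (2 ℕ.+ n) ⊕ m empty    ≲⟨ Σ<-suc-≽ s (2 ℕ.+ n) ⟩
          Σ< s (3 ℕ.+ n)              ∎
          where open ≼-Reasoning

      m-additive-≼ : ∀ {A B} → ⟦ A ⟧ ⊥ ⟦ B ⟧ → m (A ∪ B) ≼ m A ⊕ m B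
      m-additive-≼ {A} {B} A⊥B = ≼-archimedean λ j → limit j (sum-⋃ (pair A B) (pair-⊥ A⊥B) j)
        where
        limit : ∀ j → _ → m (A ∪ B) ≼ (m A ⊕ m B) ⊕ fromℚ (2^- j)
        limit j (N , h) = ≼-trans (proj₂ (h (2 ℕ.+ N) (ℕₚ.m≤n+m N 2)))
          (⊕-mono-≼ (sum-pair-≼ A B N) ≼-refl)

      m-additive-≽ : ∀ {A B} → ⟦ A ⟧ ⊥ ⟦ B ⟧ → m A ⊕ m B ≼ m (A ∪ B)
      m-additive-≽ {A} {B} A⊥B = ≼-archimedean λ j → limit j (sum-⋃ (pair A B) (pair-⊥ A⊥B) j)
        where
        limit : ∀ j → _ → m A ⊕ m B ≼ m (A ∪ B) ⊕ fromℚ (2^- j)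
        limit j (N , h) = ≼-trans (sum-pair-≽ A B N)
          (proj₁ (h (2 ℕ.+ N) (ℕₚ.m≤n+m N 2)))

      -- The points whose first occurrence is in the n-th set: disjoint pieces with the same union,
      -- to which σ-additivity applies.
      new : (ℕ → Borel) → ℕ → Borel
      new A n = A n ∖ ⋃< A n

      new-⊥ : ∀ A i j → i ≢ j → ⟦ new A i ⟧ ⊥ ⟦ new A j ⟧
      new-⊥ A i j i≢j (p , q) with ℕₚ.<-cmp i j
      ... | tri< i<j _ _ = ∖⁻ʳ {A j} {⋃< A j} q (⋃<⁺ j i<j (∩⁻ˡ {A i} {∁ ⋃< A i} p))
      ... | tri≈ _ i≡j _ = i≢j i≡j
      ... | tri> _ _ j<i = ∖⁻ʳ {A i} {⋃< A i} p (⋃<⁺ i j<i (∩⁻ˡ {A j} {∁ ⋃< A j} q))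

      ⋃<⊆⋃-new : ∀ A n → ⟦ ⋃< A n ⟧ ⊆ ⟦ ⋃ new A ⟧
      ⋃<⊆⋃-new A zero    e = ⊥-elim (e tt)
      ⋃<⊆⋃-new A (suc n) p = find em (∪⁻ p)
        where
        find : ∀ {ω} → Dec (ω ∈ ⟦ ⋃< A n ⟧) → ω ∈ ⟦ ⋃< A n ⟧ ⊎ ω ∈ ⟦ A n ⟧ → ω ∈ ⟦ ⋃ new A ⟧
        find (yes q) _        = ⋃<⊆⋃-new A n q
        find (no ¬q) (inj₁ q) = ⊥-elim (¬q q)
        find (no ¬q) (inj₂ a) = n , ∩⁺ {A n} {∁ ⋃< A n} a ¬q

      ⋃-≐-⋃-new : ∀ A → ⟦ ⋃ A ⟧ ≐ ⟦ ⋃ new A ⟧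
      ⋃-≐-⋃-new A = (λ (n , a) → ⋃<⊆⋃-new A (suc n) (∪⁺ʳ {⋃< A n} {A n} a)) ,
                    (λ (n , p) → n , ∩⁻ˡ {A n} {∁ ⋃< A n} p)

      sum-new : ∀ A n → Σ< (m ∘ new A) n ≼ m (⋃< A n)
      sum-new A zero    = ≼-trans (Σ<-zero-≼ (m ∘ new A)) (m-nonneg empty)
      sum-new A (suc n) = begin
        Σ< (m ∘ new A) (suc n)            ≲⟨ Σ<-suc-≼ (m ∘ new A) n ⟩
        Σ< (m ∘ new A) n ⊕ m (new A n)    ≲⟨ ⊕-mono-≼ (sum-new A n) ≼-refl ⟩
        m (⋃< A n) ⊕ m (new A n)                  ≲⟨ m-additive-≽ (∖-⊥ (⋃< A n) (A n)) ⟩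
        m (⋃< A n ∪ (A n ∖ ⋃< A n))               ≲⟨ m-extend (∪-∖-≐ (⋃< A n) (A n)) ⟩
        m (⋃< A n ∪ A n)                          ∎
        where open ≼-Reasoning

      -- The first `N` disjoint pieces have total mass at most that of the finite union and at least
      -- that of the whole union less 2^-j. Subtraction is avoided by adding the finite union to
      -- both sides and cancelling it.
      m-continuous : ∀ A j → ∃ λ N → m (⋃ A ∖ ⋃< A N) ≼ fromℚ (2^- j)
      m-continuous A j = limit (sum-⋃ (new A) (new-⊥ A) j)
        where
        open ≼-Reasoning
        limit : _ → ∃ λ N → m (⋃ A ∖ ⋃< A N) ≼ fromℚ (2^- j)
        limit (N , h) = N , ⊕-cancelʳ-≼ (m (⋃< A N)) (begin
          m (⋃ A ∖ ⋃< A N) ⊕ m (⋃< A N)                 ≲⟨ ⊕-comm-≼ _ _ ⟩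
          m (⋃< A N) ⊕ m (⋃ A ∖ ⋃< A N)                 ≲⟨ m-additive-≽ (∖-⊥ (⋃< A N) (⋃ A)) ⟩
          m (⋃< A N ∪ (⋃ A ∖ ⋃< A N))                   ≲⟨ m-extend (∖-split (⋃< A N) (⋃ A) (⋃<⊆⋃ A N)) ⟩
          m (⋃ A)                                       ≲⟨ m-extend (⋃-≐-⋃-new A) ⟩
          m (⋃ new A)                                   ≲⟨ proj₂ (h N ℕₚ.≤-refl) ⟩
          Σ< (m ∘ new A) N ⊕ fromℚ (2^- j)      ≲⟨ ⊕-mono-≼ (sum-new A N) ≼-refl ⟩
          m (⋃< A N) ⊕ fromℚ (2^- j)                    ≲⟨ ⊕-comm-≼ _ _ ⟩
          fromℚ (2^- j) ⊕ m (⋃< A N)                    ∎)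

    finiteMeasure : FiniteMeasure
    finiteMeasure = record
      { ∣_∣ᴹ = m ; extend = m-extend ; 0≼ = m-nonneg ; empty≼0 = m-empty
      ; additive-≼ = m-additive-≼ ; additive-≽ = m-additive-≽ ; continuous = m-continuous }

-- Clopen approximation

∷ʳ-≺⁻ : ∀ σ {b ω} → (σ ∷ʳ b) ≺ ω → σ ≺ ω × b ≡ ω (length σ)
∷ʳ-≺⁻ []      (b≡ω0 , _) = tt , b≡ω0
∷ʳ-≺⁻ (_ ∷ σ) (p , q)    = (p , proj₁ (∷ʳ-≺⁻ σ q)) , proj₂ (∷ʳ-≺⁻ σ q)

∷ʳ-≺⁺ : ∀ σ {b ω} → σ ≺ ω → b ≡ ω (length σ) → (σ ∷ʳ b) ≺ ω
∷ʳ-≺⁺ []      _       b≡ω0 = b≡ω0 , tt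
∷ʳ-≺⁺ (_ ∷ σ) (p , q) eq   = p , ∷ʳ-≺⁺ σ q eq

-- A tree describes a clopen set: the union of the cylinders at the addresses of its leaves `all`.
infixr 5 _⋎_
data Tree : Set where
  none all : Tree
  _⋎_      : Tree → Tree → Tree

clopen : List Bool → Tree → Borel
clopen σ none    = empty
clopen σ all     = cyl σ
clopen σ (l ⋎ r) = clopen (σ ∷ʳ false) l ∪ clopen (σ ∷ʳ true) r

clopen⊆cyl : ∀ σ T → ⟦ clopen σ T ⟧ ⊆ ⟦ cyl σ ⟧
clopen⊆cyl σ none    e = ⊥-elim (e tt)
clopen⊆cyl σ all     p = p
clopen⊆cyl σ (l ⋎ r) p = [ proj₁ ∘ ∷ʳ-≺⁻ σ ∘ clopen⊆cyl (σ ∷ʳ false) l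
                         , proj₁ ∘ ∷ʳ-≺⁻ σ ∘ clopen⊆cyl (σ ∷ʳ true) r ]′ (∪⁻ p)

clopen-⊥ : ∀ σ l r → ⟦ clopen (σ ∷ʳ false) l ⟧ ⊥ ⟦ clopen (σ ∷ʳ true) r ⟧
clopen-⊥ σ l r (p , q)
  with trans (proj₂ (∷ʳ-≺⁻ σ (clopen⊆cyl (σ ∷ʳ false) l p))) (sym (proj₂ (∷ʳ-≺⁻ σ (clopen⊆cyl (σ ∷ʳ true) r q))))
... | ()

infixr 6 _∨_
_∨_ : Tree → Tree → Tree
none    ∨ T         = T
all     ∨ T         = all
(l ⋎ r) ∨ none      = l ⋎ r
(l ⋎ r) ∨ all       = all
(l ⋎ r) ∨ (l′ ⋎ r′) = (l ∨ l′) ⋎ (r ∨ r′)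

clopen-∨⁻ : ∀ σ S T → ⟦ clopen σ (S ∨ T) ⟧ ⊆ ⟦ clopen σ S ∪ clopen σ T ⟧
clopen-∨⁻ σ none    T    p = ∪⁺ʳ {empty} {clopen σ T} p
clopen-∨⁻ σ all     T    p = ∪⁺ˡ {cyl σ} {clopen σ T} p
clopen-∨⁻ σ (l ⋎ r) none p = ∪⁺ˡ {clopen σ (l ⋎ r)} {empty} p
clopen-∨⁻ σ (l ⋎ r) all  p = ∪⁺ʳ {clopen σ (l ⋎ r)} {cyl σ} p
clopen-∨⁻ σ (l ⋎ r) (l′ ⋎ r′) =
  [ ∪-mono {clopen σ₀ l} {clopen σ₀ l′} {clopen σ (l ⋎ r)} {clopen σ (l′ ⋎ r′)}
      (∪⁺ˡ {clopen σ₀ l} {clopen σ₁ r}) (∪⁺ˡ {clopen σ₀ l′} {clopen σ₁ r′}) ∘ clopen-∨⁻ σ₀ l l′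
  , ∪-mono {clopen σ₁ r} {clopen σ₁ r′} {clopen σ (l ⋎ r)} {clopen σ (l′ ⋎ r′)}
      (∪⁺ʳ {clopen σ₀ l} {clopen σ₁ r}) (∪⁺ʳ {clopen σ₀ l′} {clopen σ₁ r′}) ∘ clopen-∨⁻ σ₁ r r′ ]′ ∘ ∪⁻
  where
  σ₀ = σ ∷ʳ false
  σ₁ = σ ∷ʳ true

clopen-∨⁺ˡ : ∀ σ S T → ⟦ clopen σ S ⟧ ⊆ ⟦ clopen σ (S ∨ T) ⟧
clopen-∨⁺ˡ σ none    T    e = ⊥-elim (e tt)
clopen-∨⁺ˡ σ all     T    p = p
clopen-∨⁺ˡ σ (l ⋎ r) none p = p
clopen-∨⁺ˡ σ (l ⋎ r) all  p = clopen⊆cyl σ (l ⋎ r) p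
clopen-∨⁺ˡ σ (l ⋎ r) (l′ ⋎ r′) = ∪-mono {D = clopen (σ ∷ʳ true) (r ∨ r′)} (clopen-∨⁺ˡ (σ ∷ʳ false) l l′) (clopen-∨⁺ˡ (σ ∷ʳ true) r r′)

clopen-∨⁺ʳ : ∀ σ S T → ⟦ clopen σ T ⟧ ⊆ ⟦ clopen σ (S ∨ T) ⟧
clopen-∨⁺ʳ σ none    T    p = p
clopen-∨⁺ʳ σ all     T    p = clopen⊆cyl σ T p
clopen-∨⁺ʳ σ (l ⋎ r) none e = ⊥-elim (e tt)
clopen-∨⁺ʳ σ (l ⋎ r) all  p = p
clopen-∨⁺ʳ σ (l ⋎ r) (l′ ⋎ r′) = ∪-mono {D = clopen (σ ∷ʳ true) (r ∨ r′)} (clopen-∨⁺ʳ (σ ∷ʳ false) l l′) (clopen-∨⁺ʳ (σ ∷ʳ true) r r′)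

negate : Tree → Tree
negate none    = all
negate all     = none
negate (l ⋎ r) = negate l ⋎ negate r

negate⁻ : ∀ σ T {ω} → ω ∈ ⟦ clopen σ (negate T) ⟧ → ¬ ω ∈ ⟦ clopen σ T ⟧
negate⁻ σ none    _ e = e tt
negate⁻ σ all     e _ = e tt
negate⁻ σ (l ⋎ r) p q with ∪⁻ p | ∪⁻ q
... | inj₁ p | inj₁ q = negate⁻ (σ ∷ʳ false) l p q
... | inj₁ p | inj₂ q = clopen-⊥ σ (negate l) r (p , q)
... | inj₂ p | inj₁ q = clopen-⊥ σ l (negate r) (q , p)
... | inj₂ p | inj₂ q = negate⁻ (σ ∷ʳ true) r p q

negate⁺ : ∀ σ T {ω} → σ ≺ ω → ¬ ω ∈ ⟦ clopen σ T ⟧ → ω ∈ ⟦ clopen σ (negate T) ⟧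
negate⁺ σ none    p _ = p
negate⁺ σ all     p q = ⊥-elim (q p)
negate⁺ σ (l ⋎ r) {ω} p q with ω (length σ) in eq
... | false = ∪⁺ˡ {clopen (σ ∷ʳ false) (negate l)} {clopen (σ ∷ʳ true) (negate r)}
  (negate⁺ (σ ∷ʳ false) l (∷ʳ-≺⁺ σ p (sym eq)) (q ∘ ∪⁺ˡ {clopen (σ ∷ʳ false) l} {clopen (σ ∷ʳ true) r}))
... | true  = ∪⁺ʳ {clopen (σ ∷ʳ false) (negate l)} {clopen (σ ∷ʳ true) (negate r)}
  (negate⁺ (σ ∷ʳ true) r (∷ʳ-≺⁺ σ p (sym eq)) (q ∘ ∪⁺ʳ {clopen (σ ∷ʳ false) l} {clopen (σ ∷ʳ true) r}))

path : List Bool → Tree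
path []          = all
path (false ∷ τ) = path τ ⋎ none
path (true  ∷ τ) = none ⋎ path τ

clopen-path⁻ : ∀ σ τ → ⟦ clopen σ (path τ) ⟧ ⊆ ⟦ cyl (σ ++ τ) ⟧
clopen-path⁻ σ []          {ω} p = subst (_≺ ω) (sym (Listₚ.++-identityʳ σ)) p
clopen-path⁻ σ (false ∷ τ) {ω} p =
  [ subst (_≺ ω) (Listₚ.++-assoc σ (false ∷ []) τ) ∘ clopen-path⁻ (σ ∷ʳ false) τ , (λ e → ⊥-elim (e tt)) ]′ (∪⁻ p)
clopen-path⁻ σ (true  ∷ τ) {ω} p =
  [ (λ e → ⊥-elim (e tt)) , subst (_≺ ω) (Listₚ.++-assoc σ (true ∷ []) τ) ∘ clopen-path⁻ (σ ∷ʳ true) τ ]′ (∪⁻ p)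

clopen-path⁺ : ∀ σ τ → ⟦ cyl (σ ++ τ) ⟧ ⊆ ⟦ clopen σ (path τ) ⟧
clopen-path⁺ σ []          {ω} p = subst (_≺ ω) (Listₚ.++-identityʳ σ) p
clopen-path⁺ σ (false ∷ τ) {ω} p = ∪⁺ˡ {clopen (σ ∷ʳ false) (path τ)} {empty}
  (clopen-path⁺ (σ ∷ʳ false) τ (subst (_≺ ω) (sym (Listₚ.++-assoc σ (false ∷ []) τ)) p))
clopen-path⁺ σ (true  ∷ τ) {ω} p = ∪⁺ʳ {empty} {clopen (σ ∷ʳ true) (path τ)}
  (clopen-path⁺ (σ ∷ʳ true) τ (subst (_≺ ω) (sym (Listₚ.++-assoc σ (true ∷ []) τ)) p))

Leaves : (List Bool → Set) → List Bool → Tree → Set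
Leaves P σ none    = ⊤
Leaves P σ all     = P σ
Leaves P σ (l ⋎ r) = Leaves P (σ ∷ʳ false) l × Leaves P (σ ∷ʳ true) r

module _ {P : List Bool → Set} where

  leaves-universal : (∀ τ → P τ) → ∀ σ T → Leaves P σ T
  leaves-universal p σ none    = tt
  leaves-universal p σ all     = p σ
  leaves-universal p σ (l ⋎ r) = leaves-universal p (σ ∷ʳ false) l , leaves-universal p (σ ∷ʳ true) r

  -- A leaf of the join is a leaf of one of the two trees, the shorter address winning. Joining thus
  -- selects the maximal cylinders, and no new address appears for which P would have to be shown.
  leaves-∨ : ∀ σ S T → Leaves P σ S → Leaves P σ T → Leaves P σ (S ∨ T)
  leaves-∨ σ none    T         _       q         = q
  leaves-∨ σ all     T         p       _         = p
  leaves-∨ σ (l ⋎ r) none      p       _         = p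
  leaves-∨ σ (l ⋎ r) all       _       q         = q
  leaves-∨ σ (l ⋎ r) (l′ ⋎ r′) (p , p′) (q , q′) = leaves-∨ (σ ∷ʳ false) l l′ p q , leaves-∨ (σ ∷ʳ true) r r′ p′ q′

  leaves-path : ∀ σ τ → P (σ ++ τ) → Leaves P σ (path τ)
  leaves-path σ []          p = subst P (Listₚ.++-identityʳ σ) p
  leaves-path σ (false ∷ τ) p = leaves-path (σ ∷ʳ false) τ (subst P (sym (Listₚ.++-assoc σ (false ∷ []) τ)) p) , tt
  leaves-path σ (true  ∷ τ) p = tt , leaves-path (σ ∷ʳ true) τ (subst P (sym (Listₚ.++-assoc σ (true ∷ []) τ)) p)

clopen-compare : ∀ (M M′ : FiniteMeasure) σ T →
  Leaves (λ τ → ∣ M ∣ᴹ (cyl τ) ≼ ∣ M′ ∣ᴹ (cyl τ)) σ T → ∣ M ∣ᴹ (clopen σ T) ≼ ∣ M′ ∣ᴹ (clopen σ T)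
clopen-compare M M′ σ none    _       = ≼-trans (empty≼0 M) (0≼ M′ empty)
clopen-compare M M′ σ all     p       = p
clopen-compare M M′ σ (l ⋎ r) (p , q) = begin
  ∣ M ∣ᴹ (clopen σ (l ⋎ r))                                          ≲⟨ additive-≼ M (clopen-⊥ σ l r) ⟩
  ∣ M ∣ᴹ (clopen (σ ∷ʳ false) l) ⊕ ∣ M ∣ᴹ (clopen (σ ∷ʳ true) r)
    ≲⟨ ⊕-mono-≼ (clopen-compare M M′ (σ ∷ʳ false) l p) (clopen-compare M M′ (σ ∷ʳ true) r q) ⟩
  ∣ M′ ∣ᴹ (clopen (σ ∷ʳ false) l) ⊕ ∣ M′ ∣ᴹ (clopen (σ ∷ʳ true) r)   ≲⟨ additive-≽ M′ (clopen-⊥ σ l r) ⟩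
  ∣ M′ ∣ᴹ (clopen σ (l ⋎ r))                                         ∎
  where open ≼-Reasoning

infixl 6 _△_
_△_ : Borel → Borel → Borel
A △ B = (A ∖ B) ∪ (B ∖ A)

module _ (em : ExcludedMiddle 0ℓ) where

  -- The core of Ville's inequality, used with M = 2ⁿ μ and M′ = ν. Overlapping cylinders would
  -- spoil the summation of the hypotheses, so each finite union is rewritten as a tree, whose
  -- leaves are disjoint and still among the given strings.
  open-compare : ∀ (M M′ : FiniteMeasure) σ → (∀ i → ∣ M ∣ᴹ (cyl (σ i)) ≼ ∣ M′ ∣ᴹ (cyl (σ i))) →
                 ∣ M ∣ᴹ open[ σ ] ≼ ∣ M′ ∣ᴹ full
  open-compare M M′ σ h = measure-⋃-≼ em M (cyl ∘ σ) λ n → begin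
    ∣ M ∣ᴹ (⋃< (cyl ∘ σ) n)     ≲⟨ measure-mono em M (covers n) ⟩
    ∣ M ∣ᴹ (clopen [] (T n))    ≲⟨ clopen-compare M M′ [] (T n) (leaves n) ⟩
    ∣ M′ ∣ᴹ (clopen [] (T n))   ≲⟨ measure-mono em M′ (clopen⊆cyl [] (T n)) ⟩
    ∣ M′ ∣ᴹ full                ∎
    where
    open ≼-Reasoning
    T : ℕ → Tree
    T zero    = none
    T (suc n) = T n ∨ path (σ n)
    covers : ∀ n → ⟦ ⋃< (cyl ∘ σ) n ⟧ ⊆ ⟦ clopen [] (T n) ⟧
    covers zero    e = e
    covers (suc n) p = [ clopen-∨⁺ˡ [] (T n) (path (σ n)) ∘ covers n
                       , clopen-∨⁺ʳ [] (T n) (path (σ n)) ∘ clopen-path⁺ [] (σ n) ]′ (∪⁻ p)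
    leaves : ∀ n → Leaves (λ τ → ∣ M ∣ᴹ (cyl τ) ≼ ∣ M′ ∣ᴹ (cyl τ)) [] (T n)
    leaves zero    = tt
    leaves (suc n) = leaves-∨ [] (T n) (path (σ n)) (leaves n) (leaves-path [] (σ n) (h n))

  △⁻ : ∀ A B {ω} → ω ∈ ⟦ A △ B ⟧ → (ω ∈ ⟦ A ⟧ × ¬ ω ∈ ⟦ B ⟧) ⊎ (ω ∈ ⟦ B ⟧ × ¬ ω ∈ ⟦ A ⟧)
  △⁻ A B p = [ (λ q → inj₁ (∩⁻ˡ em {A} {∁ B} q , ∖⁻ʳ {A} {B} q))
             , (λ q → inj₂ (∩⁻ˡ em {B} {∁ A} q , ∖⁻ʳ {B} {A} q)) ]′ (∪⁻ p)

  △⁺ˡ : ∀ A B {ω} → ω ∈ ⟦ A ⟧ → ¬ ω ∈ ⟦ B ⟧ → ω ∈ ⟦ A △ B ⟧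
  △⁺ˡ A B a ¬b = ∪⁺ˡ {A ∖ B} {B ∖ A} (∩⁺ {A} {∁ B} a ¬b)

  △⁺ʳ : ∀ A B {ω} → ω ∈ ⟦ B ⟧ → ¬ ω ∈ ⟦ A ⟧ → ω ∈ ⟦ A △ B ⟧
  △⁺ʳ A B b ¬a = ∪⁺ʳ {A ∖ B} {B ∖ A} (∩⁺ {B} {∁ A} b ¬a)

  -- The error is a symmetric difference because complementing both sets leaves that unchanged,
  -- which carries the induction on Borel codes through `∁`.
  Approximable : FiniteMeasure → Borel → Set
  Approximable M A = ∀ j → ∃ λ T → ∣ M ∣ᴹ (A △ clopen [] T) ≼ fromℚ (2^- j)

  module _ (M : FiniteMeasure) where

    private
      halves : ∀ {A B C} j → ⟦ C ⟧ ⊆ ⟦ A ∪ B ⟧ → ∣ M ∣ᴹ A ≼ fromℚ (2^- suc j) → ∣ M ∣ᴹ B ≼ fromℚ (2^- suc j) →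
               ∣ M ∣ᴹ C ≼ fromℚ (2^- j)
      halves {A} {B} {C} j C⊆ p q = begin
        ∣ M ∣ᴹ C                                 ≲⟨ measure-mono em M C⊆ ⟩
        ∣ M ∣ᴹ (A ∪ B)                           ≲⟨ subadditive em M A B ⟩
        ∣ M ∣ᴹ A ⊕ ∣ M ∣ᴹ B                      ≲⟨ ⊕-mono-≼ p q ⟩
        fromℚ (2^- suc j) ⊕ fromℚ (2^- suc j)    ≲⟨ fromℚ-homo-+-≽ (2^- suc j) (2^- suc j) ⟩
        fromℚ (2^- suc j + 2^- suc j)            ≡⟨ cong fromℚ (2^-halves j) ⟩
        fromℚ (2^- j)                            ∎
        where open ≼-Reasoning

      no-error : ∀ {C} j → (∀ {ω} → ¬ ω ∈ ⟦ C ⟧) → ∣ M ∣ᴹ C ≼ fromℚ (2^- j)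
      no-error j ¬C = ≼-trans (measure-mono em M λ c → ⊥-elim (¬C c)) (≼-trans (empty≼0 M) (fromℚ-mono-≼ (2^-nonneg j)))

    approximable-cyl : ∀ σ → Approximable M (cyl σ)
    approximable-cyl σ j = path σ , no-error j
      ([ (λ (p , ¬p) → ¬p (clopen-path⁺ [] σ p)) , (λ (p , ¬p) → ¬p (clopen-path⁻ [] σ p)) ]′ ∘ △⁻ (cyl σ) (clopen [] (path σ)))

    approximable-∁ : ∀ A → Approximable M A → Approximable M (∁ A)
    approximable-∁ A ap j = negate T , ≼-trans (measure-mono em M sub) (proj₂ (ap j))
      where
      T = proj₁ (ap j)
      sub : ⟦ ∁ A △ clopen [] (negate T) ⟧ ⊆ ⟦ A △ clopen [] T ⟧
      sub p = [ (λ (¬a , ¬n) → △⁺ʳ A (clopen [] T) (decidable-stable em (λ ¬c → ¬n (negate⁺ [] T tt ¬c))) ¬a)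
              , (λ (n , ¬¬a) → △⁺ˡ A (clopen [] T) (decidable-stable em ¬¬a) (negate⁻ [] T n)) ]′
              (△⁻ (∁ A) (clopen [] (negate T)) p)

    approximable-∪ : ∀ A B → Approximable M A → Approximable M B → Approximable M (A ∪ B)
    approximable-∪ A B ap bp j = S ∨ T , halves j sub (proj₂ (ap (suc j))) (proj₂ (bp (suc j)))
      where
      S = proj₁ (ap (suc j))
      T = proj₁ (bp (suc j))
      C = clopen [] S
      D = clopen [] T
      sub : ⟦ (A ∪ B) △ clopen [] (S ∨ T) ⟧ ⊆ ⟦ (A △ C) ∪ (B △ D) ⟧
      sub p = [ (λ (ab , ¬cd) → [ (λ a → ∪⁺ˡ {A △ C} {B △ D} (△⁺ˡ A C a (¬cd ∘ clopen-∨⁺ˡ [] S T)))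
                                , (λ b → ∪⁺ʳ {A △ C} {B △ D} (△⁺ˡ B D b (¬cd ∘ clopen-∨⁺ʳ [] S T))) ]′ (∪⁻ ab))
              , (λ (cd , ¬ab) → [ (λ c → ∪⁺ˡ {A △ C} {B △ D} (△⁺ʳ A C c (¬ab ∘ ∪⁺ˡ {A} {B})))
                                , (λ d → ∪⁺ʳ {A △ C} {B △ D} (△⁺ʳ B D d (¬ab ∘ ∪⁺ʳ {A} {B}))) ]′ (∪⁻ (clopen-∨⁻ [] S T cd)))
              ]′ (△⁻ (A ∪ B) (clopen [] (S ∨ T)) p)

    approximable-⋃< : ∀ A → (∀ n → Approximable M (A n)) → ∀ n → Approximable M (⋃< A n)
    approximable-⋃< A ap zero    j = none , no-error j ([ uncurry (λ e _ → e tt) , uncurry (λ e _ → e tt) ]′ ∘ △⁻ empty empty)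
    approximable-⋃< A ap (suc n)   = approximable-∪ (⋃< A n) (A n) (approximable-⋃< A ap n) (ap n)

    -- Half of the error pays for cutting the union down to finitely many sets, the other half for
    -- approximating those.
    approximable-⋃ : ∀ A → (∀ n → Approximable M (A n)) → Approximable M (⋃ A)
    approximable-⋃ A ap j = T , halves j sub (proj₂ (continuous M A (suc j))) (proj₂ approx-F)
      where
      F = ⋃< A (proj₁ (continuous M A (suc j)))
      approx-F = approximable-⋃< A ap (proj₁ (continuous M A (suc j))) (suc j)
      T = proj₁ approx-F
      C = clopen [] T
      sub : ⟦ ⋃ A △ C ⟧ ⊆ ⟦ (⋃ A ∖ F) ∪ (F △ C) ⟧
      sub {ω} p = split em (△⁻ (⋃ A) C p)
        where
        split : Dec (ω ∈ ⟦ F ⟧) → (ω ∈ ⟦ ⋃ A ⟧ × ¬ ω ∈ ⟦ C ⟧) ⊎ (ω ∈ ⟦ C ⟧ × ¬ ω ∈ ⟦ ⋃ A ⟧) → ω ∈ ⟦ (⋃ A ∖ F) ∪ (F △ C) ⟧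
        split (yes f) (inj₁ (_ , ¬c)) = ∪⁺ʳ {⋃ A ∖ F} {F △ C} (△⁺ˡ F C f ¬c)
        split (no ¬f) (inj₁ (a , _))  = ∪⁺ˡ {⋃ A ∖ F} {F △ C} (∩⁺ {⋃ A} {∁ F} a ¬f)
        split _       (inj₂ (c , ¬a)) = ∪⁺ʳ {⋃ A ∖ F} {F △ C} (△⁺ʳ F C c (¬a ∘ ⋃<⊆⋃ A (proj₁ (continuous M A (suc j)))))

    borel-approximable : ∀ A → Approximable M A
    borel-approximable (cyl σ) = approximable-cyl σ
    borel-approximable (∁ A)   = approximable-∁ A (borel-approximable A)
    borel-approximable (⋃ A)   = approximable-⋃ A (λ n → borel-approximable (A n))

  -- N restricted to the complement of U is dominated by K on every cylinder: it vanishes on those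
  -- inside U, and the others satisfy the assumed bound. Additivity extends this to clopen sets and
  -- approximation to A.
  domination-off : ∀ (N K : FiniteMeasure) U →
    (∀ τ → ⟦ cyl τ ⟧ ⊆ ⟦ U ⟧ ⊎ ∣ N ∣ᴹ (cyl τ) ≼ ∣ K ∣ᴹ (cyl τ)) →
    ∀ A → ∣ N ∣ᴹ (A ∖ U) ≼ ∣ K ∣ᴹ A
  domination-off N K U h A = ≼-archimedean bound
    where
    open ≼-Reasoning
    R = restrict em N (∁ U)
    cylinder : ∀ τ → ⟦ cyl τ ⟧ ⊆ ⟦ U ⟧ ⊎ ∣ N ∣ᴹ (cyl τ) ≼ ∣ K ∣ᴹ (cyl τ) → ∣ R ∣ᴹ (cyl τ) ≼ ∣ K ∣ᴹ (cyl τ)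
    cylinder τ (inj₁ τ⊆U) = ≼-trans (measure-mono em N {cyl τ ∖ U} {empty}
      (λ p → ⊥-elim (∖⁻ʳ {cyl τ} {U} p (τ⊆U (∩⁻ˡ em {cyl τ} {∁ U} p))))) (≼-trans (empty≼0 N) (0≼ K (cyl τ)))
    cylinder τ (inj₂ N≼K) = ≼-trans (measure-mono em N (∩⁻ˡ em {cyl τ} {∁ U})) N≼K
    bound : ∀ j → ∣ N ∣ᴹ (A ∖ U) ≼ ∣ K ∣ᴹ A ⊕ fromℚ (2^- j)
    bound j = begin
      ∣ R ∣ᴹ A                                      ≲⟨ measure-mono em R (proj₂ (∪-∖-≐ em C A) ∘ ∪⁺ʳ {C} {A}) ⟩
      ∣ R ∣ᴹ (C ∪ (A ∖ C))                          ≲⟨ subadditive em R C (A ∖ C) ⟩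
      ∣ R ∣ᴹ C ⊕ ∣ R ∣ᴹ (A ∖ C)                     ≲⟨ ⊕-mono-≼ clopen-bound error-bound ⟩
      ∣ K ∣ᴹ A ⊕ ∣ K ∣ᴹ E ⊕ ∣ N ∣ᴹ E                ≲⟨ ⊕-assoc-≼ _ _ _ ⟩
      ∣ K ∣ᴹ A ⊕ (∣ K ∣ᴹ E ⊕ ∣ N ∣ᴹ E)              ≲⟨ ⊕-mono-≼ ≼-refl (proj₂ approximation) ⟩
      ∣ K ∣ᴹ A ⊕ fromℚ (2^- j)                      ∎
      where
      -- One clopen set must suit both measures: leaving A for `C` costs N of the error set, and
      -- returning from `C` to A costs K of it.
      approximation = borel-approximable (_⊞_ em K N) A j
      T = proj₁ approximation
      C = clopen [] T
      E = A △ C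
      clopen-bound : ∣ R ∣ᴹ C ≼ ∣ K ∣ᴹ A ⊕ ∣ K ∣ᴹ E
      clopen-bound = begin
        ∣ R ∣ᴹ C                      ≲⟨ clopen-compare R K [] T (leaves-universal (λ τ → cylinder τ (h τ)) [] T) ⟩
        ∣ K ∣ᴹ C                      ≲⟨ measure-mono em K (proj₂ (∪-∖-≐ em A C) ∘ ∪⁺ʳ {A} {C}) ⟩
        ∣ K ∣ᴹ (A ∪ (C ∖ A))          ≲⟨ subadditive em K A (C ∖ A) ⟩
        ∣ K ∣ᴹ A ⊕ ∣ K ∣ᴹ (C ∖ A)     ≲⟨ ⊕-mono-≼ ≼-refl (measure-mono em K (∪⁺ʳ {A ∖ C} {C ∖ A})) ⟩
        ∣ K ∣ᴹ A ⊕ ∣ K ∣ᴹ E           ∎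
      error-bound : ∣ R ∣ᴹ (A ∖ C) ≼ ∣ N ∣ᴹ E
      error-bound = ≼-trans (measure-mono em N {(A ∖ C) ∖ U} {A ∖ C} (∩⁻ˡ em {A ∖ C} {∁ U})) (measure-mono em N (∪⁺ˡ {A ∖ C} {C ∖ A}))

-- The set of points that are not random is null

bit-parity : ∀ b c m n → bit b ℕ.+ 2 ℕ.* m ≡ bit c ℕ.+ 2 ℕ.* n → b ≡ c × m ≡ n
bit-parity false false m n eq = refl , ℕₚ.*-cancelˡ-≡ m n 2 eq
bit-parity true  true  m n eq = refl , ℕₚ.*-cancelˡ-≡ m n 2 (ℕₚ.suc-injective eq)
bit-parity false true  m n eq = ⊥-elim (ℕₚ.even≢odd m n eq)
bit-parity true  false m n eq = ⊥-elim (ℕₚ.even≢odd n m (sym eq))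

code-injective : ∀ σ τ → code σ ≡ code τ → σ ≡ τ
code-injective []      []      _  = refl
code-injective (b ∷ σ) (c ∷ τ) eq with bit-parity b c (code σ) (code τ) (ℕₚ.suc-injective eq)
... | refl , eq′ = cong (b ∷_) (code-injective σ τ eq′)

⇓-deterministic : ∀ {n} {c : Code n} {xs y z} → c [ xs ]⇓ y → c [ xs ]⇓ z → y ≡ z
⇓*-deterministic : ∀ {m n} {gs : Vec (Code n) m} {xs ys zs} →
  Pointwise (λ g y → g [ xs ]⇓ y) gs ys → Pointwise (λ g y → g [ xs ]⇓ y) gs zs → ys ≡ zs
⇓-deterministic ⇓-zero            ⇓-zero              = refl
⇓-deterministic ⇓-suc             ⇓-suc               = refl
⇓-deterministic ⇓-proj            ⇓-proj              = refl
⇓-deterministic (⇓-comp gs f)     (⇓-comp gs′ f′)     with ⇓*-deterministic gs gs′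
... | refl = ⇓-deterministic f f′
⇓-deterministic (⇓-prec-zero f)   (⇓-prec-zero f′)    = ⇓-deterministic f f′
⇓-deterministic (⇓-prec-suc r g)  (⇓-prec-suc r′ g′)  with ⇓-deterministic r r′
... | refl = ⇓-deterministic g g′
⇓-deterministic (⇓-mini {k = k} below f) (⇓-mini {k = k′} below′ f′) with ℕₚ.<-cmp k k′
... | tri≈ _ k≡k′ _ = k≡k′
... | tri< k<k′ _ _ = ⊥-elim (ℕₚ.0≢1+n (⇓-deterministic f (proj₂ (below′ k k<k′))))
... | tri> _ _ k′<k = ⊥-elim (ℕₚ.0≢1+n (sym (⇓-deterministic (proj₂ (below k′ k′<k)) f′)))
⇓*-deterministic []       []         = refl
⇓*-deterministic (g ∷ gs) (g′ ∷ gs′) = cong₂ _∷_ (⇓-deterministic g g′) (⇓*-deterministic gs gs′)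

-- Stratifies the codes for a proof of countability. The induction on depth treats all arities
-- together, since `comp` passes through an arbitrary arity and `mini` raises it.
depth  : ∀ {n} → Code n → ℕ
depth* : ∀ {m n} → Vec (Code n) m → ℕ
depth zeroᶜ       = 0
depth sucᶜ        = 0
depth (proj i)    = 0
depth (comp f gs) = suc (depth f ℕ.⊔ depth* gs)
depth (prec f g)  = suc (depth f ℕ.⊔ depth g)
depth (mini f)    = suc (depth f)
depth* []         = 0
depth* (g ∷ gs)   = depth g ℕ.⊔ depth* gs

module _ (em : ExcludedMiddle 0ℓ) (M : FiniteMeasure) where

  -- Countability of a class of indices, in the only form needed: every family of null sets
  -- has a null union over the class.
  Thin : {A : Set} → (A → Set) → Set
  Thin {A} P = ∀ (B : A → Borel) → (∀ a → Null em M (B a)) →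
               ∃ λ N → Null em M N × (∀ a → P a → ⟦ B a ⟧ ⊆ ⟦ N ⟧)

  thin-⊆ : ∀ {A} {P Q : A → Set} → (∀ a → P a → Q a) → Thin Q → Thin P
  thin-⊆ P⊆Q thin B null with thin B null
  ... | N , null-N , B⊆N = N , null-N , λ a p → B⊆N a (P⊆Q a p)

  thin-∅ : ∀ {A : Set} → Thin {A} ∅
  thin-∅ B null = empty , empty≼0 M , λ _ ()

  thin-≡ : ∀ {A : Set} (a : A) → Thin (_≡ a)
  thin-≡ a B null = B a , null a , λ { _ refl p → p }

  thin-⊎ : ∀ {A} {P Q : A → Set} → Thin P → Thin Q → Thin (λ a → P a ⊎ Q a)
  thin-⊎ {A} {P} {Q} thin-P thin-Q B null with thin-P B null | thin-Q B null
  ... | N , null-N , B⊆N | N′ , null-N′ , B⊆N′ = N ∪ N′ , null-∪ em M N N′ null-N null-N′ , sub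
    where
    sub : ∀ a → P a ⊎ Q a → ⟦ B a ⟧ ⊆ ⟦ N ∪ N′ ⟧
    sub a (inj₁ p) b = ∪⁺ˡ {N} {N′} (B⊆N a p b)
    sub a (inj₂ q) b = ∪⁺ʳ {N} {N′} (B⊆N′ a q b)

  -- A countable union of countable classes is countable: the null covers obtained from `thin-Q`,
  -- one for each a, form a family of null sets to which `thin-P` applies.
  thin-∃ : ∀ {A A′} {P : A → Set} {Q : A → A′ → Set} → Thin P → (∀ a → Thin (Q a)) → Thin (λ a′ → ∃ λ a → P a × Q a a′)
  thin-∃ {Q = Q} thin-P thin-Q B null with thin-P (λ a → proj₁ (thin-Q a B null)) (λ a → proj₁ (proj₂ (thin-Q a B null)))
  ... | N , null-N , sub = N , null-N , λ { a′ (a , p , q) b → sub a p (proj₂ (proj₂ (thin-Q a B null)) a′ q b) }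

  thin-ℕ : Thin {ℕ} U
  thin-ℕ B null = ⋃ B , null-⋃ em M B null , λ n _ b → n , b

  thin-Fin : ∀ n → Thin {Fin n} U
  thin-Fin zero    = thin-⊆ (λ ()) thin-∅
  thin-Fin (suc n) = thin-⊆ split (thin-⊎ (thin-≡ Fin.zero) (thin-∃ (thin-Fin n) (λ i → thin-≡ (Fin.suc i))))
    where
    split : ∀ (i : Fin (suc n)) → U i → i ≡ Fin.zero ⊎ ∃ λ j → U j × i ≡ Fin.suc j
    split Fin.zero    _ = inj₁ refl
    split (Fin.suc j) _ = inj₂ (j , tt , refl)

  data Node (d : ℕ) : ∀ {n} → Code n → Set where
    zeroᶜ : Node d zeroᶜ
    sucᶜ  : Node d sucᶜ
    proj  : ∀ {n} (i : Fin n) → Node d (proj i)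
    comp  : ∀ {m n} (f : Code m) (gs : Vec (Code n) m) → depth f ℕ.< d → depth* gs ℕ.< d → Node d (comp f gs)
    prec  : ∀ {n} (f : Code n) g → depth f ℕ.< d → depth g ℕ.< d → Node d (prec f g)
    mini  : ∀ {n} (f : Code (suc n)) → depth f ℕ.< d → Node d (mini f)

  node : ∀ {d n} (c : Code n) → depth c ℕ.< suc d → Node d c
  node zeroᶜ       _           = zeroᶜ
  node sucᶜ        _           = sucᶜ
  node (proj i)    _           = proj i
  node (comp f gs) (ℕ.s≤s c≤d) = comp f gs (ℕₚ.m⊔n<o⇒m<o _ _ c≤d) (ℕₚ.m⊔n<o⇒n<o (depth f) _ c≤d)
  node (prec f g)  (ℕ.s≤s c≤d) = prec f g (ℕₚ.m⊔n<o⇒m<o _ _ c≤d) (ℕₚ.m⊔n<o⇒n<o (depth f) _ c≤d)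
  node (mini f)    (ℕ.s≤s c≤d) = mini f c≤d

  module _ {d} (thin-d : ∀ n → Thin {Code n} (λ c → depth c ℕ.< d)) where

    thin-depth* : ∀ n m → Thin {Vec (Code n) m} (λ gs → depth* gs ℕ.< d)
    thin-depth* n zero    = thin-⊆ (λ { [] _ → refl }) (thin-≡ [])
    thin-depth* n (suc m) = thin-⊆
      (λ { (g ∷ gs) h → g , ℕₚ.m⊔n<o⇒m<o _ _ h , gs , ℕₚ.m⊔n<o⇒n<o (depth g) _ h , refl })
      (thin-∃ (thin-d n) (λ g → thin-∃ (thin-depth* n m) (λ gs → thin-≡ (g ∷ gs))))

    Composition Minimization : ∀ {n} → Code n → Set
    Composition {n} c = ∃ λ m → U m × ∃ λ (f : Code m) → depth f ℕ.< d ×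
                        ∃ λ (gs : Vec (Code n) m) → depth* gs ℕ.< d × c ≡ comp f gs
    Minimization {n} c = ∃ λ (f : Code (suc n)) → depth f ℕ.< d × c ≡ mini f

    thin-common : ∀ n → Thin {Code n} (λ c → (∃ λ i → U i × c ≡ proj i) ⊎ Composition c ⊎ Minimization c)
    thin-common n = thin-⊎ (thin-∃ (thin-Fin n) (λ i → thin-≡ (proj i)))
      (thin-⊎ (thin-∃ thin-ℕ (λ m → thin-∃ (thin-d m) (λ f → thin-∃ (thin-depth* n m) (λ gs → thin-≡ (comp f gs)))))
              (thin-∃ (thin-d (suc n)) (λ f → thin-≡ (mini f))))

    -- The arity is split because `zeroᶜ` exists only at arity 0, `sucᶜ` only at 1, and `prec` from
    -- 1 on. Constructors not tied to particular arities are collected in `thin-common`.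
    thin-node : ∀ n → Thin {Code n} (Node d)
    thin-node zero = thin-⊆ split (thin-⊎ (thin-≡ zeroᶜ) (thin-common zero))
      where
      split : ∀ c → Node d c → _
      split _ zeroᶜ           = inj₁ refl
      split _ (comp f gs p q) = inj₂ (inj₂ (inj₁ (_ , tt , f , p , gs , q , refl)))
      split _ (mini f p)      = inj₂ (inj₂ (inj₂ (f , p , refl)))
    thin-node (suc zero) = thin-⊆ split (thin-⊎ (thin-⊎ (thin-≡ sucᶜ) recursions) (thin-common 1))
      where
      recursions = thin-∃ (thin-d 0) (λ f → thin-∃ (thin-d 2) (λ g → thin-≡ (prec f g)))
      split : ∀ c → Node d c → _
      split _ sucᶜ            = inj₁ (inj₁ refl)
      split _ (prec f g p q)  = inj₁ (inj₂ (f , p , g , q , refl))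
      split _ (proj i)        = inj₂ (inj₁ (i , tt , refl))
      split _ (comp f gs p q) = inj₂ (inj₂ (inj₁ (_ , tt , f , p , gs , q , refl)))
      split _ (mini f p)      = inj₂ (inj₂ (inj₂ (f , p , refl)))
    thin-node (suc (suc n)) = thin-⊆ split (thin-⊎ recursions (thin-common (2 ℕ.+ n)))
      where
      recursions = thin-∃ (thin-d (1 ℕ.+ n)) (λ f → thin-∃ (thin-d (3 ℕ.+ n)) (λ g → thin-≡ (prec f g)))
      split : ∀ c → Node d c → _
      split _ (prec f g p q)  = inj₁ (f , p , g , q , refl)
      split _ (proj i)        = inj₂ (inj₁ (i , tt , refl))
      split _ (comp f gs p q) = inj₂ (inj₂ (inj₁ (_ , tt , f , p , gs , q , refl)))
      split _ (mini f p)      = inj₂ (inj₂ (inj₂ (f , p , refl)))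

  thin-depth : ∀ d n → Thin {Code n} (λ c → depth c ℕ.< d)
  thin-depth zero    n = thin-⊆ (λ _ ()) thin-∅
  thin-depth (suc d) n = thin-⊆ node (thin-node (thin-depth d) n)

  thin-Code : ∀ n → Thin {Code n} U
  thin-Code n = thin-⊆ (λ c _ → suc (depth c) , tt , ℕₚ.≤-refl) (thin-∃ thin-ℕ (λ d → thin-depth d n))

module _ (em : ExcludedMiddle 0ℓ) (ν : ProbabilityMeasure) where

  private
    M = finiteMeasure em ν

  Runs : Code 2 → (ℕ → ℕ → List Bool) → Set
  Runs c σ = (∀ m n → c [ m ∷ n ∷ [] ]⇓ code (σ m n)) × (∀ n → measure ν open[ σ n ] ≤ᴿ fromℚ (2^- n))

  ⋂open : (ℕ → ℕ → List Bool) → Borel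
  ⋂open σ = ∁ ⋃ (λ n → ∁ open[ σ n ])

  ⋂open-null : ∀ σ → (∀ n → measure ν open[ σ n ] ≤ᴿ fromℚ (2^- n)) → Null em M (⋂open σ)
  ⋂open-null σ small = ≼-archimedean λ n → begin
    measure ν (⋂open σ)       ≲⟨ measure-mono em M {⋂open σ} {open[ σ n ]} (λ p → decidable-stable em (λ ¬q → p (n , ¬q))) ⟩
    measure ν open[ σ n ]     ≲⟨ ≤ᴿ⇒≼ (small n) ⟩
    fromℚ (2^- n)             ≲⟨ ⊕-identityˡ-≽ (fromℚ (2^- n)) ⟩
    0ᴿ ⊕ fromℚ (2^- n)        ∎
    where open ≼-Reasoning

  -- Thinness asks for a family over all codes, so those that compute no test receive `empty`. Which
  -- codes these are is settled by excluded middle.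
  testSet : (c : Code 2) → Dec (∃ (Runs c)) → Borel
  testSet c (yes (σ , _)) = ⋂open σ
  testSet c (no _)        = empty

  testSet-null : ∀ c d → Null em M (testSet c d)
  testSet-null c (yes (σ , _ , small)) = ⋂open-null σ small
  testSet-null c (no _)                = empty≼0 M

  -- The sequence chosen for c may differ from σ as a function, but evaluation is deterministic and
  -- `code` is injective, so both list the same strings.
  testSet-⊇ : ∀ c d {σ ω} → Runs c σ → (∀ n → ω ∈ ⟦ open[ σ n ] ⟧) → ω ∈ ⟦ testSet c d ⟧
  testSet-⊇ c (no ¬runs)              runs       _         = ⊥-elim (¬runs (_ , runs))
  testSet-⊇ c (yes (σ′ , runs′ , _)) {σ} {ω} (runs , _) h (n , ¬q) = ¬q (transport (h n))
    where
    transport : ω ∈ ⟦ open[ σ n ] ⟧ → ω ∈ ⟦ open[ σ′ n ] ⟧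
    transport (m , p) = m , subst (_≺ ω)
      (code-injective (σ n m) (σ′ n m) (⇓-deterministic (runs n m) (runs′ n m))) p

  nonrandom-null : ∃ λ N → Null em M N × (∀ {ω} → ¬ ω ∈ ⟦ N ⟧ → ω ∈ MLR ν)
  nonrandom-null = cover (thin-Code em M 2 (λ c → testSet c em) (λ c → testSet-null c em))
    where
    cover : (∃ λ N → Null em M N × (∀ c → U c → ⟦ testSet c em ⟧ ⊆ ⟦ N ⟧)) →
            ∃ λ N → Null em M N × (∀ {ω} → ¬ ω ∈ ⟦ N ⟧ → ω ∈ MLR ν)
    cover (N , null , sub) = N , null , λ ω∉N σ ((c , runs) , small) h →
      ω∉N (sub c tt (testSet-⊇ c em (runs , small) h))

-- Computable functions

Computable : ∀ {n} → (Vec ℕ n → ℕ) → Set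
Computable {n} f = Σ (Code n) λ c → ∀ xs → c [ xs ]⇓ f xs

Computable₁ : (ℕ → ℕ) → Set
Computable₁ f = Σ (Code 1) λ c → ∀ n → c [ n ∷ [] ]⇓ f n

module _ {n : ℕ} where

  varᶜ : ∀ i → Computable {n} (λ xs → lookup xs i)
  varᶜ i = proj i , λ xs → ⇓-proj

  0ᶜ : Computable {n} (λ _ → 0)
  0ᶜ = comp zeroᶜ [] , λ xs → ⇓-comp [] ⇓-zero

  call₁ : ∀ {h f} → Computable₁ h → Computable {n} f → Computable (λ xs → h (f xs))
  call₁ (c , h⇓) (d , f⇓) = comp c (d ∷ []) , λ xs → ⇓-comp (f⇓ xs ∷ []) (h⇓ _)

  call₂ : ∀ {h f g} → Computable₂ h → Computable {n} f → Computable {n} g → Computable (λ xs → h (f xs) (g xs))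
  call₂ (c , h⇓) (d , f⇓) (e , g⇓) = comp c (d ∷ e ∷ []) , λ xs → ⇓-comp (f⇓ xs ∷ g⇓ xs ∷ []) (h⇓ _ _)

  sucᶠ : ∀ {f} → Computable {n} f → Computable (λ xs → suc (f xs))
  sucᶠ = call₁ (sucᶜ , λ n → ⇓-suc)

  primrec : ∀ (h : ℕ → Vec ℕ n → ℕ) (s : Vec ℕ (2 ℕ.+ n) → ℕ) → Computable (h 0) → Computable s →
            (∀ k xs → s (k ∷ h k xs ∷ xs) ≡ h (suc k) xs) →
            Σ (Code (1 ℕ.+ n)) λ c → ∀ k xs → c [ k ∷ xs ]⇓ h k xs
  primrec h s (f , f⇓) (g , g⇓) step = prec f g , run
    where
    run : ∀ k xs → prec f g [ k ∷ xs ]⇓ h k xs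
    run zero    xs = ⇓-prec-zero (f⇓ xs)
    run (suc k) xs = subst (prec f g [ suc k ∷ xs ]⇓_) (step k xs) (⇓-prec-suc (run k xs) (g⇓ _))

primrec₁ : ∀ (h : ℕ → ℕ) (s : Vec ℕ 2 → ℕ) → Computable {0} (λ _ → h 0) → Computable s →
           (∀ k → s (k ∷ h k ∷ []) ≡ h (suc k)) → Computable₁ h
primrec₁ h s base step eq with primrec (λ k _ → h k) s base step (λ { k [] → eq k })
... | c , h⇓ = c , λ k → h⇓ k []

primrec₂ : ∀ (h : ℕ → ℕ → ℕ) (s : Vec ℕ 3 → ℕ) → Computable {1} (λ xs → h 0 (lookup xs Fin.zero)) → Computable s →
           (∀ k x → s (k ∷ h k x ∷ x ∷ []) ≡ h (suc k) x) → Computable₂ h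
primrec₂ h s base step eq with primrec (λ k xs → h k (lookup xs Fin.zero)) s base step (λ { k (x ∷ []) → eq k x })
... | c , h⇓ = c , λ k x → h⇓ k (x ∷ [])

+-computable : Computable₂ ℕ._+_
+-computable = primrec₂ ℕ._+_ _ (varᶜ 0F) (sucᶠ (varᶜ 1F)) (λ _ _ → refl)

*-computable : Computable₂ ℕ._*_
*-computable = primrec₂ ℕ._*_ _ 0ᶜ (call₂ +-computable (varᶜ 2F) (varᶜ 1F)) (λ _ _ → refl)

pred-computable : Computable₁ ℕ.pred
pred-computable = primrec₁ ℕ.pred _ 0ᶜ (varᶜ 0F) (λ _ → refl)

-- Primitive recursion runs on the first argument, and truncated subtraction recurses on the number
-- subtracted.
flip-∸-computable : Computable₂ (λ n m → m ℕ.∸ n)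
flip-∸-computable = primrec₂ (λ n m → m ℕ.∸ n) _ (varᶜ 0F) (call₁ pred-computable (varᶜ 1F)) (λ n m → ℕₚ.pred[m∸n]≡m∸[1+n] m n)

module _ {n : ℕ} {f g : Vec ℕ n → ℕ} where

  infixl 6 _+ᶜ_ _∸ᶜ_
  infixl 7 _*ᶜ_
  _+ᶜ_ : Computable f → Computable g → Computable (λ xs → f xs ℕ.+ g xs)
  _+ᶜ_ = call₂ +-computable

  _*ᶜ_ : Computable f → Computable g → Computable (λ xs → f xs ℕ.* g xs)
  _*ᶜ_ = call₂ *-computable

  _∸ᶜ_ : Computable f → Computable g → Computable (λ xs → f xs ℕ.∸ g xs)
  F ∸ᶜ G = call₂ flip-∸-computable G F

2^-computable : Computable₁ (2 ℕ.^_)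
2^-computable = primrec₁ (2 ℕ.^_) _ (sucᶠ 0ᶜ) (sucᶠ (sucᶠ 0ᶜ) *ᶜ varᶜ 1F) (λ _ → refl)

unlessZero : ℕ → ℕ → ℕ
unlessZero zero    _ = 0
unlessZero (suc _) x = x

unlessZero-computable : Computable₂ unlessZero
unlessZero-computable = primrec₂ unlessZero _ 0ᶜ (varᶜ 2F) (λ _ _ → refl)

-- 0, 0,1, 0,1,2,3, 0,…,7, …: every number occurs infinitely often.
sweep : ℕ → ℕ
sweep zero    = 0
sweep (suc k) = unlessZero (k ℕ.∸ (sweep k ℕ.+ sweep k)) (suc (sweep k))

sweep-computable : Computable₁ sweep
sweep-computable = primrec₁ sweep _ 0ᶜ
  (call₂ unlessZero-computable (varᶜ 0F ∸ᶜ (varᶜ 1F +ᶜ varᶜ 1F)) (sucᶠ (varᶜ 1F))) (λ _ → refl)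

unlessZero-positive : ∀ {t} x → 0 ℕ.< t → unlessZero t x ≡ x
unlessZero-positive {suc t} x _ = refl

-- At position r + x the tested difference is (r + x) - 2x = r - x, so a run begun at r climbs to r
-- before it restarts.
sweep-run : ∀ {r} → sweep r ≡ 0 → ∀ {x} → x ℕ.≤ r → sweep (r ℕ.+ x) ≡ x
sweep-run {r} start {zero}  _   = trans (cong sweep (ℕₚ.+-identityʳ r)) start
sweep-run {r} start {suc x} x<r = begin
  sweep (r ℕ.+ suc x)                                     ≡⟨ cong sweep (ℕₚ.+-suc r x) ⟩
  sweep (suc (r ℕ.+ x))                                   ≡⟨ cong (λ s → unlessZero (r ℕ.+ x ℕ.∸ (s ℕ.+ s)) (suc s)) (sweep-run start (ℕₚ.<⇒≤ x<r)) ⟩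
  unlessZero (r ℕ.+ x ℕ.∸ (x ℕ.+ x)) (suc x)              ≡⟨ unlessZero-positive (suc x) (ℕₚ.m<n⇒0<n∸m (ℕₚ.+-monoˡ-< x x<r)) ⟩
  suc x                                                   ∎
  where open ≡-Reasoning

sweep-restart : ∀ m → ∃ λ r → m ℕ.≤ r × sweep r ≡ 0
sweep-restart zero    = 0 , ℕ.z≤n , refl
sweep-restart (suc m) with sweep-restart m
... | r , m≤r , start = suc (r ℕ.+ r) , ℕ.s≤s (ℕₚ.≤-trans m≤r (ℕₚ.m≤m+n r r)) , (begin
  unlessZero (r ℕ.+ r ℕ.∸ (sweep (r ℕ.+ r) ℕ.+ sweep (r ℕ.+ r))) (suc (sweep (r ℕ.+ r)))
    ≡⟨ cong (λ s → unlessZero (r ℕ.+ r ℕ.∸ (s ℕ.+ s)) (suc s)) (sweep-run start ℕₚ.≤-refl) ⟩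
  unlessZero (r ℕ.+ r ℕ.∸ (r ℕ.+ r)) (suc r)   ≡⟨ cong (λ t → unlessZero t (suc r)) (ℕₚ.n∸n≡0 (r ℕ.+ r)) ⟩
  0                                            ∎)
  where open ≡-Reasoning

-- The index k will be both the stage that inspects string `sweep k` and the precision of that
-- inspection. Recurrence submits every string to arbitrarily fine precision without a pairing
-- function.
sweep-recurrent : ∀ x m → ∃ λ k → m ℕ.≤ k × sweep k ≡ x
sweep-recurrent x m with sweep-restart (m ℕ.⊔ x)
... | r , m⊔x≤r , start = r ℕ.+ x , ℕₚ.≤-trans (ℕₚ.m≤m⊔n m x) (ℕₚ.≤-trans m⊔x≤r (ℕₚ.m≤m+n r x)) ,
                          sweep-run start (ℕₚ.≤-trans (ℕₚ.m≤n⊔m m x) m⊔x≤r)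

-- Counting through the binary strings, and unbounded search

increment : List Bool → List Bool
increment []          = false ∷ []
increment (false ∷ σ) = true ∷ σ
increment (true ∷ σ)  = false ∷ increment σ

code-increment : ∀ σ → code (increment σ) ≡ suc (code σ)
code-increment []          = refl
code-increment (false ∷ σ) = refl
code-increment (true ∷ σ)  = cong suc (trans (cong (2 ℕ.*_) (code-increment σ)) (ℕₚ.*-suc 2 (code σ)))

decode : ℕ → List Bool
decode zero    = []
decode (suc n) = increment (decode n)

code-decode : ∀ n → code (decode n) ≡ n
code-decode zero    = refl
code-decode (suc n) = trans (code-increment (decode n)) (cong suc (code-decode n))

decode-code : ∀ σ → decode (code σ) ≡ σ
decode-code σ = code-injective (decode (code σ)) σ (code-decode (code σ))

-- Shaped to supply the premises of `⇓-mini`, which wants the earlier values exhibited as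
-- successors.
least-zero : ∀ (f : ℕ → ℕ) n → f n ≡ 0 →
             ∃ λ k → f k ≡ 0 × (∀ i → i ℕ.< k → ∃ λ y → f i ≡ suc y)
least-zero f zero    fn≡0 = 0 , fn≡0 , λ _ ()
least-zero f (suc n) fn≡0 with f 0 in f0
... | zero  = 0 , f0 , λ _ ()
... | suc y with least-zero (f ∘ suc) n fn≡0
...   | k , fk≡0 , below = suc k , fk≡0 , λ { zero _ → y , f0 ; (suc i) (ℕ.s≤s i<k) → below i i<k }

-- Makes a total enumeration out of a decidable set of stages: position m yields the first zero from
-- m on. A zero is sent to itself, so none is lost, and infinitely many zeros make the search total.
next-zero : ∀ (f : ℕ → ℕ → ℕ) → Computable₂ f → (∀ n m → ∃ λ k → m ℕ.≤ k × f n k ≡ 0) →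
            ∃ λ h → Computable₂ h × (∀ n m → f n (h n m) ≡ 0) × (∀ n m → f n m ≡ 0 → h n m ≡ m)
next-zero f f-comp io = h , (proj₁ h-comp , λ n m → proj₂ h-comp (n ∷ m ∷ [])) , (λ n m → proj₁ (proj₂ (search n m))) , at-zero
  where
  from : ∀ n m → ∃ λ j → f n (m ℕ.+ j) ≡ 0
  from n m with io n m
  ... | k , m≤k , eq = k ℕ.∸ m , trans (cong (f n) (ℕₚ.m+[n∸m]≡n m≤k)) eq
  search : ∀ n m → ∃ λ j → f n (m ℕ.+ j) ≡ 0 × (∀ i → i ℕ.< j → ∃ λ y → f n (m ℕ.+ i) ≡ suc y)
  search n m = least-zero (λ j → f n (m ℕ.+ j)) (proj₁ (from n m)) (proj₂ (from n m))
  h : ℕ → ℕ → ℕ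
  h n m = m ℕ.+ proj₁ (search n m)
  shifted : Computable {3} (λ xs → f (lookup xs 1F) (lookup xs 2F ℕ.+ lookup xs 0F))
  shifted = call₂ f-comp (varᶜ 1F) (varᶜ 2F +ᶜ varᶜ 0F)
  least-comp : Computable₂ (λ n m → proj₁ (search n m))
  least-comp = mini (proj₁ shifted) , λ n m → ⇓-mini
    (λ i i<j → proj₁ (proj₂ (proj₂ (search n m)) i i<j) ,
       subst (proj₁ shifted [ i ∷ n ∷ m ∷ [] ]⇓_) (proj₂ (proj₂ (proj₂ (search n m)) i i<j)) (proj₂ shifted (i ∷ n ∷ m ∷ [])))
    (subst (proj₁ shifted [ proj₁ (search n m) ∷ n ∷ m ∷ [] ]⇓_) (proj₁ (proj₂ (search n m))) (proj₂ shifted _))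
  h-comp : Computable {2} (λ xs → h (lookup xs 0F) (lookup xs 1F))
  h-comp = varᶜ 1F +ᶜ call₂ least-comp (varᶜ 0F) (varᶜ 1F)
  at-zero : ∀ n m → f n m ≡ 0 → h n m ≡ m
  at-zero n m eq = go (search n m)
    where
    go : (s : ∃ λ j → f n (m ℕ.+ j) ≡ 0 × (∀ i → i ℕ.< j → ∃ λ y → f n (m ℕ.+ i) ≡ suc y)) → m ℕ.+ proj₁ s ≡ m
    go (zero  , _)         = ℕₚ.+-identityʳ m
    go (suc j , _ , below) with below 0 (ℕ.s≤s ℕ.z≤n)
    ... | y , eq′ = ⊥-elim (ℕₚ.0≢1+n (trans (sym eq) (trans (cong (f n) (sym (ℕₚ.+-identityʳ m))) eq′)))

-- The likelihood-ratio test

-- A threshold which exceeds 2^n p even after an error of 2^-k in p and in the compared number.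
threshold : ℕ → ℕ → ℚ → ℚ
threshold n k p = fromℕ (2 ℕ.^ n) * (p + fromℕ 2 * 2^- k)

-- x ⇝ p keeps the natural number x inferable, unlike fromℕ x ≡ p.
infix 4 _⇝_
record _⇝_ (x : ℕ) (p : ℚ) : Set where
  constructor is
  field value : fromℕ x ≡ p

open _⇝_

# : ∀ x → x ⇝ fromℕ x
# x = is refl

infixl 6 _⊹_
infixl 7 _⊛_
_⊹_ : ∀ {x y p r} → x ⇝ p → y ⇝ r → x ℕ.+ y ⇝ p + r
_⊹_ {x} {y} eq eq′ = is (trans (fromℕ-homo-+ x y) (cong₂ _+_ (value eq) (value eq′)))

_⊛_ : ∀ {x y p r} → x ⇝ p → y ⇝ r → x ℕ.* y ⇝ p * r
_⊛_ {x} {y} eq eq′ = is (trans (fromℕ-homo-* x y) (cong₂ _*_ (value eq) (value eq′)))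

module _ (a b d a′ b′ d′ n k : ℕ) where

  -- The two sides of threshold n k ((a′ − b′)/(d′ + 1)) ≤ (a − b)/(d + 1) after clearing
  -- denominators and moving negative terms across.
  lower upper : ℕ
  lower = 2 ℕ.^ n ℕ.* (a′ ℕ.* 2 ℕ.^ k ℕ.* suc d ℕ.+ 2 ℕ.* (suc d ℕ.* suc d′)) ℕ.+ b ℕ.* 2 ℕ.^ k ℕ.* suc d′
  upper = a ℕ.* 2 ℕ.^ k ℕ.* suc d′ ℕ.+ 2 ℕ.^ n ℕ.* (b′ ℕ.* 2 ℕ.^ k ℕ.* suc d)

  private
    q  = (a ⊖ b) / suc d
    q′ = (a′ ⊖ b′) / suc d′
    N  = fromℕ (2 ℕ.^ n)
    P  = fromℕ (2 ℕ.^ k)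
    E  = fromℕ (suc d)
    E′ = fromℕ (suc d′)
    D  = E * (P * E′)

    lower⇝ : lower ⇝ N * (fromℕ a′ * P * E + fromℕ 2 * (E * E′)) + fromℕ b * P * E′
    lower⇝ = (# (2 ℕ.^ n) ⊛ (# a′ ⊛ # (2 ℕ.^ k) ⊛ # (suc d) ⊹ # 2 ⊛ (# (suc d) ⊛ # (suc d′)))) ⊹ # b ⊛ # (2 ℕ.^ k) ⊛ # (suc d′)

    upper⇝ : upper ⇝ fromℕ a * P * E′ + N * (fromℕ b′ * P * E)
    upper⇝ = # a ⊛ # (2 ℕ.^ k) ⊛ # (suc d′) ⊹ # (2 ℕ.^ n) ⊛ (# b′ ⊛ # (2 ℕ.^ k) ⊛ # (suc d))

    -- That 2^-k times `P` is 1 is no ring identity. The factor 1 is therefore kept visible here and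
    -- exchanged for that product before `factor` applies.
    collect : ∀ A B A′ B′ N P E E′ t →
      (A * P * E′ + N * (B′ * P * E)) - (N * (A′ * P * E + t * (E * E′)) + B * P * E′) ≡
      (A - B) * P * E′ - N * ((A′ - B′) * P * E + t * 1ℚ * (E * E′))
    collect = solve 9 (λ A B A′ B′ N P E E′ t →
      (A :* P :* E′ :+ N :* (B′ :* P :* E)) :- (N :* (A′ :* P :* E :+ t :* (E :* E′)) :+ B :* P :* E′) :=
      (A :- B) :* P :* E′ :- N :* ((A′ :- B′) :* P :* E :+ t :* con 1ℚ :* (E :* E′))) refl

    factor : ∀ q q′ e N P E E′ t →
      (q * E) * P * E′ - N * ((q′ * E′) * P * E + t * (e * P) * (E * E′)) ≡
      q * (E * (P * E′)) - N * (q′ + t * e) * (E * (P * E′))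
    factor = solve 8 (λ q q′ e N P E E′ t →
      (q :* E) :* P :* E′ :- N :* ((q′ :* E′) :* P :* E :+ t :* (e :* P) :* (E :* E′)) :=
      q :* (E :* (P :* E′)) :- N :* (q′ :+ t :* e) :* (E :* (P :* E′))) refl

  upper-lower : fromℕ upper - fromℕ lower ≡ q * D - threshold n k q′ * D
  upper-lower = begin
    fromℕ upper - fromℕ lower
      ≡⟨ cong₂ _-_ (value upper⇝) (value lower⇝) ⟩
    (fromℕ a * P * E′ + N * (fromℕ b′ * P * E)) - (N * (fromℕ a′ * P * E + fromℕ 2 * (E * E′)) + fromℕ b * P * E′)
      ≡⟨ collect (fromℕ a) (fromℕ b) (fromℕ a′) (fromℕ b′) N P E E′ (fromℕ 2) ⟩
    (fromℕ a - fromℕ b) * P * E′ - N * ((fromℕ a′ - fromℕ b′) * P * E + fromℕ 2 * 1ℚ * (E * E′))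
      ≡⟨ cong₂ (λ x y → x * P * E′ - N * (y * P * E + fromℕ 2 * 1ℚ * (E * E′))) (⊖-/-*-denominator a b d) (⊖-/-*-denominator a′ b′ d′) ⟨
    (q * E) * P * E′ - N * ((q′ * E′) * P * E + fromℕ 2 * 1ℚ * (E * E′))
      ≡⟨ cong (λ x → (q * E) * P * E′ - N * ((q′ * E′) * P * E + fromℕ 2 * x * (E * E′))) (2^-inverse k) ⟨
    (q * E) * P * E′ - N * ((q′ * E′) * P * E + fromℕ 2 * (2^- k * P) * (E * E′))
      ≡⟨ factor q q′ (2^- k) N P E E′ (fromℕ 2) ⟩
    q * D - threshold n k q′ * D ∎
    where open ≡-Reasoning

  private
    D-positive : ℚ.Positive D
    D-positive = ℚₚ.pos*pos⇒pos E {{positive d}} (P * E′)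
      {{ℚₚ.pos*pos⇒pos P {{ℚ.positive (fromℕ-mono-< {0} {2 ℕ.^ k} (ℕₚ.≤-<-trans ℕ.z≤n (n<2^n k)))}} E′ {{positive d′}}}}
      where
      positive : ∀ e → ℚ.Positive (fromℕ (suc e))
      positive e = ℚ.positive (fromℕ-suc-positive e)

  lower≤upper⇒threshold≤ : lower ℕ.≤ upper → threshold n k q′ ≤ q
  lower≤upper⇒threshold≤ l≤u =
    ℚₚ.*-cancelʳ-≤-pos D {{D-positive}} (≤-by-difference (fromℕ-mono-≤ l≤u) (sym upper-lower))

  threshold≤⇒lower≤upper : threshold n k q′ ≤ q → lower ℕ.≤ upper
  threshold≤⇒lower≤upper t≤q =
    fromℕ-cancel-≤ (≤-by-difference (ℚₚ.*-monoʳ-≤-nonNeg D {{ℚₚ.pos⇒nonNeg D {{D-positive}}}} t≤q) upper-lower)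

-- Stage k examines the string numbered `sweep k` at precision k. With denominators cleared, passing
-- means that a truncated difference of naturals is 0, which is the form that minimization searches
-- for.
threshold-decidable : ∀ {q q′} → Computable₂ℚ q → Computable₂ℚ q′ →
  ∃ λ f → Computable₂ f × (∀ n k → f n k ≡ 0 → threshold n k (q′ (sweep k) k) ≤ q (sweep k) k) ×
                          (∀ n k → threshold n k (q′ (sweep k) k) ≤ q (sweep k) k → f n k ≡ 0)
threshold-decidable {q} {q′} (a , b , d , a-comp , b-comp , d-comp , q≡) (a′ , b′ , d′ , a′-comp , b′-comp , d′-comp , q′≡) =
  f , (proj₁ f-comp , λ n k → proj₂ f-comp (n ∷ k ∷ [])) ,
  (λ n k eq → subst₂ (λ p r → threshold n k p ≤ r) (sym (q′≡ (sweep k) k)) (sym (q≡ (sweep k) k))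
    (lower≤upper⇒threshold≤ (a (sweep k) k) (b (sweep k) k) (d (sweep k) k) (a′ (sweep k) k) (b′ (sweep k) k) (d′ (sweep k) k) n k
      (ℕₚ.m∸n≡0⇒m≤n eq))) ,
  (λ n k h → ℕₚ.m≤n⇒m∸n≡0
    (threshold≤⇒lower≤upper (a (sweep k) k) (b (sweep k) k) (d (sweep k) k) (a′ (sweep k) k) (b′ (sweep k) k) (d′ (sweep k) k) n k
      (subst₂ (λ p r → threshold n k p ≤ r) (q′≡ (sweep k) k) (q≡ (sweep k) k) h)))
  where
  f : ℕ → ℕ → ℕ
  f n k = on lower ℕ.∸ on upper
    where
    on : (ℕ → ℕ → ℕ → ℕ → ℕ → ℕ → ℕ → ℕ → ℕ) → ℕ
    on g = g (a (sweep k) k) (b (sweep k) k) (d (sweep k) k) (a′ (sweep k) k) (b′ (sweep k) k) (d′ (sweep k) k) n k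
  f-comp : Computable {2} (λ xs → f (lookup xs 0F) (lookup xs 1F))
  f-comp = (N *ᶜ (at a′-comp *ᶜ P *ᶜ sucᶠ (at d-comp) +ᶜ sucᶠ (sucᶠ 0ᶜ) *ᶜ (sucᶠ (at d-comp) *ᶜ sucᶠ (at d′-comp)))
             +ᶜ at b-comp *ᶜ P *ᶜ sucᶠ (at d′-comp))
           ∸ᶜ (at a-comp *ᶜ P *ᶜ sucᶠ (at d′-comp) +ᶜ N *ᶜ (at b′-comp *ᶜ P *ᶜ sucᶠ (at d-comp)))
    where
    at : ∀ {g} → Computable₂ g → Computable {2} (λ xs → g (sweep (lookup xs 1F)) (lookup xs 1F))
    at g-comp = call₂ g-comp (call₁ sweep-computable (varᶜ 1F)) (varᶜ 1F)
    N = call₁ 2^-computable (varᶜ {2} 0F)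
    P = call₁ 2^-computable (varᶜ {2} 1F)

-- Multiplication by powers of two, and the correctness of the threshold

double^ : ℕ → ℝ → ℝ
double^ zero    x = x
double^ (suc n) x = double^ n x ⊕ double^ n x

double^-mono : ∀ n {x y} → x ≼ y → double^ n x ≼ double^ n y
double^-mono zero    p = p
double^-mono (suc n) p = ⊕-mono-≼ (double^-mono n p) (double^-mono n p)

double^-homo-⊕ : ∀ n x y → double^ n (x ⊕ y) ≼ double^ n x ⊕ double^ n y
double^-homo-⊕ zero    x y = ≼-refl
double^-homo-⊕ (suc n) x y = ≼-trans (⊕-mono-≼ (double^-homo-⊕ n x y) (double^-homo-⊕ n x y)) (⊕-medial-≼ _ _ _ _)

2^suc-* : ∀ n p → fromℕ (2 ℕ.^ suc n) * p ≡ fromℕ (2 ℕ.^ n) * p + fromℕ (2 ℕ.^ n) * p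
2^suc-* n p = trans (cong (_* p) (fromℕ-homo-* 2 (2 ℕ.^ n))) (lemma (fromℕ (2 ℕ.^ n)) p)
  where
  lemma : ∀ N p → fromℕ 2 * N * p ≡ N * p + N * p
  lemma = solve 2 (λ N p → con (fromℕ 2) :* N :* p := N :* p :+ N :* p) refl

double^-fromℚ-≼ : ∀ n p → double^ n (fromℚ p) ≼ fromℚ (fromℕ (2 ℕ.^ n) * p)
double^-fromℚ-≼ zero    p = fromℚ-mono-≼ (ℚₚ.≤-reflexive (sym (ℚₚ.*-identityˡ p)))
double^-fromℚ-≼ (suc n) p = begin
  double^ n (fromℚ p) ⊕ double^ n (fromℚ p)                          ≲⟨ ⊕-mono-≼ (double^-fromℚ-≼ n p) (double^-fromℚ-≼ n p) ⟩
  fromℚ (fromℕ (2 ℕ.^ n) * p) ⊕ fromℚ (fromℕ (2 ℕ.^ n) * p)          ≲⟨ fromℚ-homo-+-≽ _ _ ⟩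
  fromℚ (fromℕ (2 ℕ.^ n) * p + fromℕ (2 ℕ.^ n) * p)                  ≡⟨ cong fromℚ (2^suc-* n p) ⟨
  fromℚ (fromℕ (2 ℕ.^ suc n) * p)                                    ∎
  where open ≼-Reasoning

double^-fromℚ-≽ : ∀ n p → fromℚ (fromℕ (2 ℕ.^ n) * p) ≼ double^ n (fromℚ p)
double^-fromℚ-≽ zero    p = fromℚ-mono-≼ (ℚₚ.≤-reflexive (ℚₚ.*-identityˡ p))
double^-fromℚ-≽ (suc n) p = begin
  fromℚ (fromℕ (2 ℕ.^ suc n) * p)                                    ≡⟨ cong fromℚ (2^suc-* n p) ⟩
  fromℚ (fromℕ (2 ℕ.^ n) * p + fromℕ (2 ℕ.^ n) * p)                  ≲⟨ fromℚ-homo-+-≼ _ _ ⟩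
  fromℚ (fromℕ (2 ℕ.^ n) * p) ⊕ fromℚ (fromℕ (2 ℕ.^ n) * p)          ≲⟨ ⊕-mono-≼ (double^-fromℚ-≽ n p) (double^-fromℚ-≽ n p) ⟩
  double^ n (fromℚ p) ⊕ double^ n (fromℚ p)                          ∎
  where open ≼-Reasoning

double^-cancel : ∀ n m {x} → double^ n x ≼ fromℚ (2^- m) → x ≼ fromℚ (2^- (n ℕ.+ m))
double^-cancel zero    m p = p
double^-cancel (suc n) m {x} p = subst (λ e → x ≼ fromℚ (2^- e)) (ℕₚ.+-suc n m)
  (double^-cancel n (suc m) (double-cancel-≼ (begin
    double^ n x ⊕ double^ n x                  ≲⟨ p ⟩
    fromℚ (2^- m)                              ≡⟨ cong fromℚ (2^-halves m) ⟨
    fromℚ (2^- suc m + 2^- suc m)              ≲⟨ fromℚ-homo-+-≼ _ _ ⟩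
    fromℚ (2^- suc m) ⊕ fromℚ (2^- suc m)      ∎)))
  where open ≼-Reasoning

double^-zero : ∀ n {x} → x ≼ 0ᴿ → double^ n x ≼ 0ᴿ
double^-zero zero    p = p
double^-zero (suc n) p = ≼-trans (⊕-mono-≼ (double^-zero n p) (double^-zero n p)) (⊕-identityʳ-≼ 0ᴿ)

2^-cancel : ∀ n j → fromℕ (2 ℕ.^ n) * 2^- (n ℕ.+ j) ≡ 2^- j
2^-cancel zero    j = ℚₚ.*-identityˡ (2^- j)
2^-cancel (suc n) j = begin
  fromℕ (2 ℕ.^ suc n) * 2^- (suc n ℕ.+ j)                                      ≡⟨ 2^suc-* n (2^- (suc n ℕ.+ j)) ⟩
  N * 2^- (suc n ℕ.+ j) + N * 2^- (suc n ℕ.+ j)                                ≡⟨ ℚₚ.*-distribˡ-+ N _ _ ⟨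
  N * (2^- (suc n ℕ.+ j) + 2^- (suc n ℕ.+ j))                                  ≡⟨ cong (N *_) (2^-halves (n ℕ.+ j)) ⟩
  N * 2^- (n ℕ.+ j)                                                            ≡⟨ 2^-cancel n j ⟩
  2^- j                                                                        ∎
  where
  open ≡-Reasoning
  N = fromℕ (2 ℕ.^ n)

2^-≤-scaled : ∀ n k → 2^- k ≤ fromℕ (2 ℕ.^ n) * 2^- k
2^-≤-scaled n k = subst (_≤ fromℕ (2 ℕ.^ n) * 2^- k) (ℚₚ.*-identityˡ (2^- k))
  (ℚₚ.*-monoʳ-≤-nonNeg (2^- k) {{ℚ.nonNegative (2^-nonneg k)}} (fromℕ-mono-≤ {1} (ℕₚ.m^n>0 2 n)))

-- Of the two units 2^-k inside the threshold, one absorbs the error of p′. The other, scaled up to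
-- 2ⁿ 2^-k ≥ 2^-k, absorbs that of p.
threshold-sound : ∀ n k {p p′ u v} → v ≼ fromℚ p′ ⊕ fromℚ (2^- k) → fromℚ p ≼ u ⊕ fromℚ (2^- k) →
                  threshold n k p′ ≤ p → double^ n v ≼ u
threshold-sound n k {p} {p′} {u} {v} v≼p′ p≼u t≤p = ⊕-cancelʳ-≼ (fromℚ e) (begin
  double^ n v ⊕ fromℚ e                     ≲⟨ ⊕-mono-≼ (double^-mono n (≼-trans v≼p′ (fromℚ-homo-+-≽ p′ e))) ≼-refl ⟩
  double^ n (fromℚ (p′ + e)) ⊕ fromℚ e      ≲⟨ ⊕-mono-≼ (double^-fromℚ-≼ n (p′ + e)) ≼-refl ⟩
  fromℚ (N * (p′ + e)) ⊕ fromℚ e            ≲⟨ fromℚ-homo-+-≽ (N * (p′ + e)) e ⟩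
  fromℚ (N * (p′ + e) + e)                  ≲⟨ fromℚ-mono-≼ (≤-by-difference (2^-≤-scaled n k) (lemma N p′ e)) ⟩
  fromℚ (threshold n k p′)                  ≲⟨ fromℚ-mono-≼ t≤p ⟩
  fromℚ p                                   ≲⟨ p≼u ⟩
  u ⊕ fromℚ e                               ∎)
  where
  open ≼-Reasoning
  e = 2^- k
  N = fromℕ (2 ℕ.^ n)
  lemma : ∀ N p e → N * (p + fromℕ 2 * e) - (N * (p + e) + e) ≡ N * e - e
  lemma = solve 3 (λ N p e → N :* (p :+ con (fromℕ 2) :* e) :- (N :* (p :+ e) :+ e) := N :* e :- e) refl

-- The losses amount to at most four units 2ⁿ 2^-k: one from p′, two from the threshold and one from
-- p. For k ≥ n + j + 2 they fit into the gap 2^-j.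
threshold-complete : ∀ n k j {p p′ u v} → fromℚ p′ ≼ v ⊕ fromℚ (2^- k) → u ≼ fromℚ p ⊕ fromℚ (2^- k) →
                     2 ℕ.+ (n ℕ.+ j) ℕ.≤ k → double^ n v ⊕ fromℚ (2^- j) ≼ u → threshold n k p′ ≤ p
threshold-complete n k j {p} {p′} {u} {v} p′≼v u≼p k-large gap = fromℚ-cancel-≼ (⊕-cancelʳ-≼ (fromℚ e) (begin
  fromℚ (threshold n k p′) ⊕ fromℚ e                        ≲⟨ fromℚ-homo-+-≽ (threshold n k p′) e ⟩
  fromℚ (threshold n k p′ + e)                              ≲⟨ fromℚ-mono-≼ (≤-by-difference (2^-≤-scaled n k) (lemma N p′ e)) ⟩
  fromℚ (N * p′ + N * (e + e + e))                          ≲⟨ fromℚ-homo-+-≼ (N * p′) (N * (e + e + e)) ⟩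
  fromℚ (N * p′) ⊕ fromℚ (N * (e + e + e))                  ≲⟨ ⊕-mono-≼ scaled ≼-refl ⟩
  double^ n v ⊕ fromℚ (N * e) ⊕ fromℚ (N * (e + e + e))     ≲⟨ ⊕-assoc-≼ _ _ _ ⟩
  double^ n v ⊕ (fromℚ (N * e) ⊕ fromℚ (N * (e + e + e)))   ≲⟨ ⊕-mono-≼ ≼-refl (fromℚ-homo-+-≽ (N * e) (N * (e + e + e))) ⟩
  double^ n v ⊕ fromℚ (N * e + N * (e + e + e))             ≲⟨ ⊕-mono-≼ ≼-refl (fromℚ-mono-≼ small) ⟩
  double^ n v ⊕ fromℚ (2^- j)                               ≲⟨ gap ⟩
  u                                                         ≲⟨ u≼p ⟩
  fromℚ p ⊕ fromℚ e                                         ∎))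
  where
  open ≼-Reasoning
  e = 2^- k
  N = fromℕ (2 ℕ.^ n)
  lemma : ∀ N p e → (N * p + N * (e + e + e)) - (N * (p + fromℕ 2 * e) + e) ≡ N * e - e
  lemma = solve 3 (λ N p e → (N :* p :+ N :* (e :+ e :+ e)) :- (N :* (p :+ con (fromℕ 2) :* e) :+ e) := N :* e :- e) refl
  scaled : fromℚ (N * p′) ≼ double^ n v ⊕ fromℚ (N * e)
  scaled = begin
    fromℚ (N * p′)                          ≲⟨ double^-fromℚ-≽ n p′ ⟩
    double^ n (fromℚ p′)                    ≲⟨ double^-mono n p′≼v ⟩
    double^ n (v ⊕ fromℚ e)                 ≲⟨ double^-homo-⊕ n v (fromℚ e) ⟩
    double^ n v ⊕ double^ n (fromℚ e)       ≲⟨ ⊕-mono-≼ ≼-refl (double^-fromℚ-≼ n e) ⟩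
    double^ n v ⊕ fromℚ (N * e)             ∎
  collect : ∀ N e → N * e + N * (e + e + e) ≡ N * ((e + e) + (e + e))
  collect = solve 2 (λ N e → N :* e :+ N :* (e :+ e :+ e) := N :* ((e :+ e) :+ (e :+ e))) refl
  small : N * e + N * (e + e + e) ≤ 2^- j
  small = subst₂ _≤_ (sym (collect N e)) (trans (cong (N *_) (2^-quarters (n ℕ.+ j))) (2^-cancel n j))
    (ℚₚ.*-monoˡ-≤-nonNeg N {{ℚ.nonNegative (fromℕ-nonneg (2 ℕ.^ n))}}
      (ℚₚ.+-mono-≤ (ℚₚ.+-mono-≤ e≤ e≤) (ℚₚ.+-mono-≤ e≤ e≤)))
    where e≤ = 2^-antimono k-large

-- Construction of the test and absolute continuity

module _ (em : ExcludedMiddle 0ℓ) where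

  doubled : ℕ → FiniteMeasure → FiniteMeasure
  doubled zero    M = M
  doubled (suc n) M = _⊞_ em (doubled n M) (doubled n M)

  doubled≡ : ∀ n M A → ∣ doubled n M ∣ᴹ A ≡ double^ n (∣ M ∣ᴹ A)
  doubled≡ zero    M A = refl
  doubled≡ (suc n) M A = cong₂ _⊕_ (doubled≡ n M A) (doubled≡ n M A)

  module _ (ν μ : ProbabilityMeasure) where

    private
      V = finiteMeasure em ν
      W = finiteMeasure em μ

    Bounded : ℕ → List Bool → Set
    Bounded n τ = measure ν (cyl τ) ≼ double^ n (measure μ (cyl τ))

    bounded-off⇒null : ∀ n U → (∀ τ → ⟦ cyl τ ⟧ ⊆ ⟦ U ⟧ ⊎ Bounded n τ) → ∀ A → measure μ A ≼ 0ᴿ → measure ν (A ∖ U) ≼ 0ᴿ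
    bounded-off⇒null n U h A μA≼0 = begin
      measure ν (A ∖ U)        ≲⟨ domination-off em V (doubled n W) U (λ τ → [ inj₁ , inj₂ ∘ subst (measure ν (cyl τ) ≼_) (sym (doubled≡ n W (cyl τ))) ]′ (h τ)) A ⟩
      ∣ doubled n W ∣ᴹ A       ≡⟨ doubled≡ n W A ⟩
      double^ n (measure μ A)  ≲⟨ double^-zero n μA≼0 ⟩
      0ᴿ                       ∎
      where open ≼-Reasoning

    open-small : ∀ n σ → (∀ i → double^ n (measure μ (cyl (σ i))) ≼ measure ν (cyl (σ i))) →
                 measure μ open[ σ ] ≤ᴿ fromℚ (2^- n)
    open-small n σ h = ≼⇒≤ᴿ (subst (λ m → measure μ open[ σ ] ≼ fromℚ (2^- m)) (ℕₚ.+-identityʳ n) (double^-cancel n 0 (begin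
      double^ n (measure μ open[ σ ])   ≡⟨ doubled≡ n W open[ σ ] ⟨
      ∣ doubled n W ∣ᴹ open[ σ ]        ≲⟨ open-compare em (doubled n W) V σ (λ i → subst (_≼ measure ν (cyl (σ i))) (sym (doubled≡ n W (cyl (σ i)))) (h i)) ⟩
      measure ν full                    ≲⟨ ≤ᴿ⇒≼ (proj₁ (total ν)) ⟩
      1ᴿ                                ∎)))
      where open ≼-Reasoning

    -- The last hypothesis keeps the enumeration total: one unbounded string at level n passes at
    -- infinitely many stages, so the search for a passed stage always halts.
    likelihood-test : ComputableMeasure ν → ComputableMeasure μ → (∀ n → ∃ λ τ → ¬ Bounded n τ) →
      ∃ λ σ → MLTest μ σ × (∀ n τ → ⟦ cyl τ ⟧ ⊆ ⟦ open[ σ n ] ⟧ ⊎ Bounded n τ)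
    likelihood-test (q , q-comp , q-close) (q′ , q′-comp , q′-close) unbounded =
      build (threshold-decidable q-comp q′-comp)
      where
      Passed : ℕ → ℕ → Set
      Passed n k = threshold n k (q′ (sweep k) k) ≤ q (sweep k) k

      passed⇒≼ : ∀ n k → Passed n k → double^ n (measure μ (cyl (decode (sweep k)))) ≼ measure ν (cyl (decode (sweep k)))
      passed⇒≼ n k passed = threshold-sound n k
        (≼-trans (≤ᴿ⇒≼ (proj₂ (q′-close (decode (sweep k)) k))) (+ᴿ-≼-⊕ (fromℚ (q′ (code (decode (sweep k))) k)) (fromℚ (2^- k))))
        (≼-trans (≤ᴿ⇒≼ (proj₁ (q-close (decode (sweep k)) k))) (+ᴿ-≼-⊕ (measure ν (cyl (decode (sweep k)))) (fromℚ (2^- k))))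
        (subst (λ x → threshold n k (q′ x k) ≤ q x k) (sym (code-decode (sweep k))) passed)

      unbounded⇒passed : ∀ n τ → ¬ Bounded n τ → ∀ m → ∃ λ k → m ℕ.≤ k × sweep k ≡ code τ × Passed n k
      unbounded⇒passed n τ ¬bounded m = locate (⋠⇒gap em ¬bounded)
        where
        locate : (∃ λ j → double^ n (measure μ (cyl τ)) ⊕ fromℚ (2^- j) ≼ measure ν (cyl τ)) →
                 ∃ λ k → m ℕ.≤ k × sweep k ≡ code τ × Passed n k
        -- The stage must lie beyond m and be precise enough for `threshold-complete`; a recurrence
        -- past the maximum of the two bounds does both.
        locate (j , gap) = accept (sweep-recurrent (code τ) (m ℕ.⊔ (2 ℕ.+ (n ℕ.+ j))))
          where
          accept : (∃ λ k → m ℕ.⊔ (2 ℕ.+ (n ℕ.+ j)) ℕ.≤ k × sweep k ≡ code τ) →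
                   ∃ λ k → m ℕ.≤ k × sweep k ≡ code τ × Passed n k
          accept (k , k-large , eq) = k , ℕₚ.≤-trans (ℕₚ.m≤m⊔n m (2 ℕ.+ (n ℕ.+ j))) k-large , eq ,
            subst (λ x → threshold n k (q′ x k) ≤ q x k) (sym eq)
              (threshold-complete n k j
                (≼-trans (≤ᴿ⇒≼ (proj₁ (q′-close τ k))) (+ᴿ-≼-⊕ (measure μ (cyl τ)) (fromℚ (2^- k))))
                (≼-trans (≤ᴿ⇒≼ (proj₂ (q-close τ k))) (+ᴿ-≼-⊕ (fromℚ (q (code τ) k)) (fromℚ (2^- k))))
                (ℕₚ.≤-trans (ℕₚ.m≤n⊔m m (2 ℕ.+ (n ℕ.+ j))) k-large) gap)

      build : (∃ λ f → Computable₂ f × (∀ n k → f n k ≡ 0 → Passed n k) × (∀ n k → Passed n k → f n k ≡ 0)) →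
              ∃ λ σ → MLTest μ σ × (∀ n τ → ⟦ cyl τ ⟧ ⊆ ⟦ open[ σ n ] ⟧ ⊎ Bounded n τ)
      build (f , f-comp , f≡0⇒passed , passed⇒f≡0) = enumerate (next-zero f f-comp λ n m → recurs n m (unbounded n))
        where
        recurs : ∀ n m → (∃ λ τ → ¬ Bounded n τ) → ∃ λ k → m ℕ.≤ k × f n k ≡ 0
        recurs n m (τ , ¬bounded) =
          let k , m≤k , _ , passed = unbounded⇒passed n τ ¬bounded m in k , m≤k , passed⇒f≡0 n k passed

        enumerate : (∃ λ h → Computable₂ h × (∀ n m → f n (h n m) ≡ 0) × (∀ n m → f n m ≡ 0 → h n m ≡ m)) →
                    ∃ λ σ → MLTest μ σ × (∀ n τ → ⟦ cyl τ ⟧ ⊆ ⟦ open[ σ n ] ⟧ ⊎ Bounded n τ)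
        enumerate (h , h-comp , h-zero , h-fixed) = σ , (σ-comp , σ-small) , λ n τ → covered n τ em
          where
          σ : ℕ → ℕ → List Bool
          σ n m = decode (sweep (h n m))
          sweep-h-comp : Computable {2} (λ xs → sweep (h _ _))
          sweep-h-comp = call₁ sweep-computable (call₂ h-comp (varᶜ 0F) (varᶜ 1F))
          σ-comp : Computable₂String σ
          σ-comp = proj₁ sweep-h-comp , λ n m →
            subst (proj₁ sweep-h-comp [ _ ]⇓_) (sym (code-decode (sweep (h n m)))) (proj₂ sweep-h-comp _)
          σ-small : ∀ n → measure μ open[ σ n ] ≤ᴿ fromℚ (2^- n)
          σ-small n = open-small n (σ n) λ m → passed⇒≼ n (h n m) (f≡0⇒passed n (h n m) (h-zero n m))
          covered : ∀ n τ → Dec (Bounded n τ) → ⟦ cyl τ ⟧ ⊆ ⟦ open[ σ n ] ⟧ ⊎ Bounded n τ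
          covered n τ (yes bounded) = inj₂ bounded
          covered n τ (no ¬bounded) = inj₁ λ {ω} p →
            -- The search stays put at a stage that passes, so τ itself is the string listed at
            -- position k.
            let k , _ , eq , passed = unbounded⇒passed n τ ¬bounded 0
            in k , subst (_≺ ω) (sym (trans (cong (decode ∘ sweep) (h-fixed n k (passed⇒f≡0 n k passed)))
                                            (trans (cong decode eq) (decode-code τ)))) p

    null-by-test : ν ≪MLR μ → ∀ σ → MLTest μ σ → (∀ n τ → ⟦ cyl τ ⟧ ⊆ ⟦ open[ σ n ] ⟧ ⊎ Bounded n τ) →
                   ∀ A → measure μ A ≼ 0ᴿ → measure ν A ≼ 0ᴿ
    null-by-test ν≪μ σ test covers A μA≼0 = conclude (nonrandom-null em ν)
      where
      outside : ℕ → Borel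
      outside n = A ∖ open[ σ n ]
      conclude : (∃ λ N → measure ν N ≼ 0ᴿ × (∀ {ω} → ¬ ω ∈ ⟦ N ⟧ → ω ∈ MLR ν)) → measure ν A ≼ 0ᴿ
      conclude (N , N-null , random) = ≼-trans (measure-mono em V sub)
        (null-∪ em V N (⋃ outside) N-null
          (null-⋃ em V outside (λ n → bounded-off⇒null n open[ σ n ] (covers n) A μA≼0)))
        where
        locate : ∀ {ω} → ω ∈ ⟦ A ⟧ → Dec (ω ∈ ⟦ N ⟧) → ω ∈ ⟦ N ∪ ⋃ outside ⟧
        locate a (yes p) = ∪⁺ˡ {N} {⋃ outside} p
        locate {ω} a (no ¬p) = ∪⁺ʳ {N} {⋃ outside} (decidable-stable em λ inside →
          ν≪μ (random ¬p) σ test λ n → decidable-stable em λ ¬q → inside (n , ∩⁺ {A} {∁ open[ σ n ]} a ¬q))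
        sub : ⟦ A ⟧ ⊆ ⟦ N ∪ ⋃ outside ⟧
        sub a = locate a em

proposition4p2 : ExcludedMiddle 0ℓ → (ν μ : ProbabilityMeasure) →
    ComputableMeasure ν → ComputableMeasure μ →
    FullSupport ν → FullSupport μ →
    ν ≪MLR μ → ν ≪ μ
proposition4p2 em ν μ ν-comp μ-comp _ _ ν≪μ A (μA≤0 , _) = ≼⇒≤ᴿ (null em) , nonneg ν A
  where
  null : Dec (∃ λ n → ∀ τ → Bounded em ν μ n τ) → measure ν A ≼ 0ᴿ
  -- Here no level-n test set is needed: with U empty, every cylinder falls under the bounded
  -- alternative.
  null (yes (n , bounded)) =
    ≼-trans (measure-mono em (finiteMeasure em ν) {A} {A ∖ empty} (λ a → ∩⁺ {A} {∁ empty} a (λ e → e tt)))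
      (bounded-off⇒null em ν μ n empty (inj₂ ∘ bounded) A (≤ᴿ⇒≼ μA≤0))
  null (no never) = by-test (likelihood-test em ν μ ν-comp μ-comp λ n →
      decidable-stable em λ none → never (n , λ τ → decidable-stable em λ ¬bounded → none (τ , ¬bounded)))
    where
    by-test : (∃ λ σ → MLTest μ σ × (∀ n τ → ⟦ cyl τ ⟧ ⊆ ⟦ open[ σ n ] ⟧ ⊎ Bounded em ν μ n τ)) → measure ν A ≼ 0ᴿ
    by-test (σ , test , covers) = null-by-test em ν μ ν≪μ σ test covers A (≤ᴿ⇒≼ μA≤0)
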